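{- For every integer $i\ge1$: if $i=1$ then $J(3i,2i-1)=J(3,1)=4$, and if $i\ge2$ then \[ J(3i,\,2i-1)=\binom{2i-2}{i}\cdot\frac{9i^2+3i-4}{2(i-1)}. \]
   Context: Let $\pi=\pi_1\cdots\pi_n$ be a permutation of $[n]$. An entry $\pi_i$ is a left-to-right minimum if $\pi_j>\pi_i$ for all $j<i$. Let the left-to-right minima of $\pi$ be at positions $k_1<k_2<\dots<k_a$ (so $\pi_{k_1}>\dots>\pi_{k_a}$), and set $\pi_{k_0}:=n+1$ and $k_{a+1}:=n+1$. The staircase grid $B_a$ consists of the boxes $(i,j)$ with $1\le i\le j\le a$, where $i$ is the row index counted from the top and $j$ is the column index counted from the left. The staircase encoding of $\pi$ fills box $(i,j)$ of $B_a$ with the number of indices $p$ with $k_j<p<k_{j+1}$ and $\pi_{k_i}<\pi_p<\pi_{k_{i-1}}$. A permutation $\pi$ contains $132$ if there are indices $p<q<r$ with $\pi_p<\pi_r<\pi_q$, and avoids $132$ otherwise. For integers $\ell\ge1$, $k\ge0$, let $J(\ell,k)$ denote the number of $132$-avoiding permutations of $[\ell]$ whose staircase encoding has exactly $k$ nonzero boxes. -}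

module Defs where

open import Data.Nat using (ℕ; zero; suc; _+_; _∸_; _<ᵇ_; _≡ᵇ_)
open import Data.Bool using (Bool; true; false; _∧_; _∨_; not; if_then_else_)
open import Data.List using (List; []; _∷_; length; filter; map; upTo; concatMap; applyUpTo)
open import Data.Bool.ListAction using (any; all)
open import Relation.Nullary.Decidable using (Dec; yes; no)
open import Data.Bool.Properties using () renaming (_≟_ to _≟ᵇ_)
open import Data.Product using (_×_; _,_; proj₁; proj₂)

-- A permutation of [n] is represented by its one-line notation π₁ ⋯ πₙ as a
-- list of naturals.  We use values 0,…,n-1 instead of 1,…,n (an
-- order-isomorphic relabelling; all notions below only compare values)
-- and positions 0,…,n-1 instead of 1,…,n.

at : List ℕ → ℕ → ℕ → ℕ
at []       p       d = d
at (x ∷ xs) zero    d = x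
at (x ∷ xs) (suc p) d = at xs p d

allLists : ℕ → ℕ → List (List ℕ)
allLists zero    n = [] ∷ []
allLists (suc m) n = concatMap (λ x → map (x ∷_) (allLists m n)) (upTo n)

distinct : List ℕ → Bool
distinct []       = true
distinct (x ∷ xs) = not (any (λ y → x ≡ᵇ y) xs) ∧ distinct xs

permutations : ℕ → List (List ℕ)
permutations n = filter (λ π → distinct π ≟ᵇ true) (allLists n n)

contains132 : List ℕ → Bool
contains132 π =
  any (λ r → any (λ q → any (λ p →
        (at π p 0 <ᵇ at π r 0) ∧ (at π r 0 <ᵇ at π q 0))
      (upTo q)) (upTo r)) (upTo (length π))

avoids132 : List ℕ → Bool
avoids132 π = not (contains132 π)

lrMinPositions : List ℕ → List ℕ
lrMinPositions π =
  filter (λ p → all (λ q → at π p 0 <ᵇ at π q 0) (upTo p) ≟ᵇ true)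
         (upTo (length π))

-- Staircase encoding.  With n = length π, ks = (k₁,…,k_a):
--   k_j          = at ks (j ∸ 1) n           (1 ≤ j ≤ a)
--   k_{a+1}      = n   (one past the last 0-based position, i.e. "n+1")
--   π_{k_0}      = n   (one above the largest 0-based value, i.e. "n+1")
-- box (i,j), 1 ≤ i ≤ j ≤ a, holds the number of positions p with
--   k_j < p < k_{j+1}  and  π_{k_i} < π_p < π_{k_{i-1}}.
module _ (π : List ℕ) where
  private
    n  = length π
    ks = lrMinPositions π

  kpos : ℕ → ℕ
  kpos j = at ks (j ∸ 1) n

  kval : ℕ → ℕ
  kval zero    = n
  kval (suc i) = at π (kpos (suc i)) 0

  box : ℕ → ℕ → ℕ
  box i j = length (filter (λ p →
              ((kpos j <ᵇ p) ∧ (p <ᵇ kpos (suc j)) ∧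
               (kval i <ᵇ at π p 0) ∧ (at π p 0 <ᵇ kval (i ∸ 1))) ≟ᵇ true)
            (upTo n))

  nonzeroBoxes : ℕ
  nonzeroBoxes =
    length (filter (λ ij → (0 <ᵇ box (proj₁ ij) (proj₂ ij)) ≟ᵇ true)
      (concatMap (λ j → map (λ i → (i , j)) (applyUpTo suc j))
                 (applyUpTo suc (length ks))))

J : ℕ → ℕ → ℕ
J ℓ k = length (filter (λ π → (avoids132 π ∧ (nonzeroBoxes π ≡ᵇ k)) ≟ᵇ true)
                       (permutations ℓ))

-- A nonempty 132-avoider with maximum n is α′ n β, where every entry of α′
-- exceeds every entry of β and α (α′ standardised) and β avoid 132; here it is
-- called glue α β.  Gluing adds up the nonzero boxes of α and β, plus one more
-- exactly when α is nonempty and its top right box (1, a) is empty.  Weigh an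
-- avoider of length ℓ with k nonzero boxes by 2ℓ − 3k.  This is at least 1 for
-- nonempty avoiders and at least 2 if in addition the top right box is
-- empty, and J(3i, 2i−1) counts the avoiders of length 3i of weight 3.
-- Hence the decomposition yields a finite polynomial system for the generating
-- series (in the size, marked by x) of the classes of weight at most 4.
-- Eliminating all but the weight-1 series a = x (x + a²) and putting
-- s = 1 − 2xa, so that s² = 1 − 4x³, the series F of weight 3 satisfies
-- s³ (1 + F) = (1 − x³)², and s⁻³ has the coefficients (2m+1) C(2m,m) at x^{3m}.

module Submission where

open import Defs
open import Data.Nat
open import Data.Nat.Properties
open import Data.Nat.Combinatorics using (_C_; nCk≡n!/k![n-k]!; k![n∸k]!∣n!; nCk≡nC[n∸k])
open import Data.Nat.DivMod using (m/n*n≡m)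
open import Data.Nat.Tactic.RingSolver using (solve-∀)
open import Data.Bool using (Bool; true; false; _∧_; not; T; if_then_else_)
open import Data.Bool.Properties using (∧-zeroʳ; ∧-comm) renaming (_≟_ to _≟ᵇ_)
open import Data.Bool.ListAction using (any; all)
open import Data.List using (List; []; _∷_; [_]; _++_; _∷ʳ_; length; map; filter; null; upTo; applyUpTo; concatMap;
  cartesianProduct; cartesianProductWith)
open import Data.List.Properties
open import Data.List.Membership.Propositional using (_∈_)
open import Data.List.Membership.Propositional.Properties
open import Data.List.Membership.DecPropositional _≟_ using (_∈?_)
open import Data.List.Relation.Unary.Any using (here; there)
open import Data.List.Relation.Unary.All as All using (All; []; _∷_)
import Data.List.Relation.Unary.All.Properties as All
open import Data.List.Relation.Unary.AllPairs using ([]; _∷_)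
open import Data.List.Relation.Unary.Unique.Propositional using (Unique)
import Data.List.Relation.Unary.Unique.Propositional.Properties as Unique
open import Data.Product using (_×_; _,_; proj₁; proj₂; ∃; ∃₂; uncurry)
open import Data.Sum using (inj₁; inj₂)
open import Data.Maybe as Maybe using (Maybe)
open import Data.Empty using (⊥-elim)
open import Function using (_∘_; id)
open import Level using (0ℓ)
open import Relation.Nullary using (¬_; yes; no; contradiction)
open import Relation.Nullary.Decidable using (dec⇒maybe)
open import Relation.Binary.PropositionalEquality hiding ([_]; J)
open import Algebra.Bundles using (CommutativeRing)
open import Algebra.Properties.CommutativeSemigroup +-commutativeSemigroup using () renaming (interchange to +-interchange)
open import Algebra.Solver.Ring.AlmostCommutativeRing using (fromCommutativeRing; _-Raw-AlmostCommutative⟶_)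
import Algebra.Solver.Ring as RingSolver

-- Central binomial coefficients

-- The system is not visibly finite. In `glue α β` the part α contributes its weight plus 2 if its
-- top right box is filled, its weight minus 1 if α is nonempty and that box is empty, and 2 if α is
-- empty. So the equation for weight w involves avoiders of weight w + 1. This excess cancels: left
-- weight w occurs there only with β empty, and the avoiders `glue α []` with α nonempty are exactly
-- those with filled top right box. Subtracting their series removes the highest unknown.
--
-- The resulting equations of n = `cornerEmpty 3` and e = `cornerFilled 3` are linear in n and in e
-- respectively, both with leading coefficient s = 1 - 2xa, and that of e is quadratic in n. This is
-- why s³ clears all denominators.
--
-- No root or quotient of series is formed: s is a polynomial in x and a, and the candidate for its
-- inverse cube is verified through a linear differential equation for x d/dx, which is the
-- recurrence of its coefficients. The elimination subtracts, hence series over the integers.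

C*factorials : ∀ {n k} → k ≤ n → (n C k) * (k ! * (n ∸ k) !) ≡ n !
C*factorials {n} {k} k≤n = trans (cong (_* (k ! * (n ∸ k) !)) (nCk≡n!/k![n-k]! k≤n))
  (m/n*n≡m (k![n∸k]!∣n! k≤n))
  where instance _ = k !* (n ∸ k) !≢0

absorption : ∀ {n k} → k ≤ n → suc k * (suc n C suc k) ≡ suc n * (n C k)
absorption {n} {k} k≤n = *-cancelʳ-≡ _ _ (k ! * (n ∸ k) !) (begin
  suc k * (suc n C suc k) * (k ! * (n ∸ k) !)   ≡⟨ rearrange (suc k) (suc n C suc k) (k !) ((n ∸ k) !) ⟩
  (suc n C suc k) * (suc k ! * (n ∸ k) !)       ≡⟨ C*factorials (s≤s k≤n) ⟩
  suc n * n !                                   ≡⟨ cong (suc n *_) (C*factorials k≤n) ⟨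
  suc n * ((n C k) * (k ! * (n ∸ k) !))         ≡⟨ *-assoc (suc n) (n C k) _ ⟨
  suc n * (n C k) * (k ! * (n ∸ k) !)           ∎)
  where
  open ≡-Reasoning
  instance _ = k !* (n ∸ k) !≢0
  rearrange : ∀ a b c d → a * b * (c * d) ≡ b * (a * c * d)
  rearrange = solve-∀

central : ℕ → ℕ
central m = (2 * m) C m

private
  half-step : ∀ m → suc m * (suc (2 * m) C suc m) ≡ suc (2 * m) * central m
  half-step m = absorption (m≤m+n m (m + 0))

-- Two absorptions, joined by the symmetry C(2m+1, m) = C(2m+1, m+1).
central-suc : ∀ m → suc m * central (suc m) ≡ 2 * (suc (2 * m) * central m)
central-suc m = begin
  suc m * ((2 * suc m) C suc m)                ≡⟨ cong (λ k → suc m * (k C suc m)) (*-suc 2 m) ⟩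
  suc m * (suc (suc (2 * m)) C suc m)          ≡⟨ absorption (m≤n⇒m≤1+n (m≤m+n m (m + 0))) ⟩
  suc (suc (2 * m)) * (suc (2 * m) C m)        ≡⟨ cong (suc (suc (2 * m)) *_) (nCk≡nC[n∸k] (m≤n⇒m≤1+n (m≤m+n m (m + 0)))) ⟩
  suc (suc (2 * m)) * (suc (2 * m) C (suc (2 * m) ∸ m))
    ≡⟨ cong (λ k → suc (suc (2 * m)) * (suc (2 * m) C k)) complement ⟩
  suc (suc (2 * m)) * (suc (2 * m) C suc m)    ≡⟨ cong (_* (suc (2 * m) C suc m)) (*-suc 2 m) ⟨
  2 * suc m * (suc (2 * m) C suc m)            ≡⟨ *-assoc 2 (suc m) (suc (2 * m) C suc m) ⟩
  2 * (suc m * (suc (2 * m) C suc m))          ≡⟨ cong (2 *_) (half-step m) ⟩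
  2 * (suc (2 * m) * central m)                ∎
  where
  open ≡-Reasoning
  complement : suc (2 * m) ∸ m ≡ suc m
  complement = trans (cong (_∸ m) (shape m)) (m+n∸m≡n m (suc m))
    where
    shape : ∀ m → suc (2 * m) ≡ m + suc m
    shape = solve-∀

-- The left side carries the binomial coefficient of the theorem, C(2i-2, i) at i = m + 2.
above-central : ∀ m → suc (suc m) * ((2 * suc m) C suc (suc m)) ≡ 2 * (suc (2 * m) * central m)
above-central m = begin
  suc (suc m) * ((2 * suc m) C suc (suc m))           ≡⟨ cong (λ k → suc (suc m) * (k C suc (suc m))) (*-suc 2 m) ⟩
  suc (suc m) * (suc (suc (2 * m)) C suc (suc m))     ≡⟨ absorption (s≤s (m≤m+n m (m + 0))) ⟩
  suc (suc (2 * m)) * (suc (2 * m) C suc m)           ≡⟨ cong (_* (suc (2 * m) C suc m)) (*-suc 2 m) ⟨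
  2 * suc m * (suc (2 * m) C suc m)                   ≡⟨ *-assoc 2 (suc m) (suc (2 * m) C suc m) ⟩
  2 * (suc m * (suc (2 * m) C suc m))                 ≡⟨ cong (2 *_) (half-step m) ⟩
  2 * (suc (2 * m) * central m)                       ∎
  where open ≡-Reasoning

cubeCoeff : ℕ → ℕ
cubeCoeff m = suc (2 * m) * central m

-- In coefficients, this is the differential equation (1 - 4y) h′ = 6h of h = (1 - 4y)^(-3/2).
cubeCoeff-suc : ∀ m → suc m * cubeCoeff (suc m) ≡ (4 * m + 6) * cubeCoeff m
cubeCoeff-suc m = begin
  suc m * (suc (2 * suc m) * central (suc m))        ≡⟨ swap m (central (suc m)) ⟩
  (2 * m + 3) * (suc m * central (suc m))            ≡⟨ cong ((2 * m + 3) *_) (central-suc m) ⟩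
  (2 * m + 3) * (2 * (suc (2 * m) * central m))      ≡⟨ expand m (suc (2 * m) * central m) ⟩
  (4 * m + 6) * cubeCoeff m                          ∎
  where
  open ≡-Reasoning
  swap : ∀ m c → suc m * (suc (2 * suc m) * c) ≡ (2 * m + 3) * (suc m * c)
  swap = solve-∀
  expand : ∀ m c → (2 * m + 3) * (2 * c) ≡ (4 * m + 6) * c
  expand = solve-∀

-- Everything is expressed through C(2m,m); here i = m + 2.
closedForm : ∀ m j → j + 2 * cubeCoeff (suc m) ≡ cubeCoeff (2 + m) + cubeCoeff m →
  2 * suc m * j ≡ ((2 * suc m) C suc (suc m)) * (9 * m * m + 39 * m + 38)
-- The factor 2 + m turns `b` into 2 `c₀` and lets `c₂` be lowered to `c₁`; adding a multiple of
-- `c₁` to both sides avoids subtraction in ℕ.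
closedForm m j eq = *-cancelˡ-≡ _ _ (2 + m) (+-cancelʳ-≡ (4 * (2 + m) * (suc m * c₁)) _ _ (begin
  (2 + m) * (2 * suc m * j) + 4 * (2 + m) * (suc m * c₁)
    ≡⟨ collect m j c₁ ⟩
  2 * suc m * (2 + m) * (j + 2 * c₁)
    ≡⟨ cong (2 * suc m * (2 + m) *_) eq ⟩
  2 * suc m * (2 + m) * (c₂ + c₀)
    ≡⟨ expand₂ m c₂ c₀ ⟩
  2 * suc m * ((2 + m) * c₂) + 2 * suc m * (2 + m) * c₀
    ≡⟨ cong (λ z → 2 * suc m * z + 2 * suc m * (2 + m) * c₀) (cubeCoeff-suc (suc m)) ⟩
  2 * suc m * ((4 * suc m + 6) * c₁) + 2 * suc m * (2 + m) * c₀
    ≡⟨ regroup m c₁ c₀ ⟩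
  2 * (4 * m + 10) * (suc m * c₁) + 2 * suc m * (2 + m) * c₀
    ≡⟨ cong (λ z → 2 * (4 * m + 10) * z + 2 * suc m * (2 + m) * c₀) (cubeCoeff-suc m) ⟩
  2 * (4 * m + 10) * ((4 * m + 6) * c₀) + 2 * suc m * (2 + m) * c₀
    ≡⟨ balance m c₀ ⟩
  2 * c₀ * (9 * m * m + 39 * m + 38) + 4 * (2 + m) * ((4 * m + 6) * c₀)
    ≡⟨ cong₂ (λ y z → y * (9 * m * m + 39 * m + 38) + 4 * (2 + m) * z) (above-central m) (cubeCoeff-suc m) ⟨
  (2 + m) * b * (9 * m * m + 39 * m + 38) + 4 * (2 + m) * (suc m * c₁)
    ≡⟨ cong (_+ 4 * (2 + m) * (suc m * c₁)) (*-assoc (2 + m) b _) ⟩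
  (2 + m) * (b * (9 * m * m + 39 * m + 38)) + 4 * (2 + m) * (suc m * c₁) ∎))
  where
  open ≡-Reasoning
  c₀ = cubeCoeff m
  c₁ = cubeCoeff (suc m)
  c₂ = cubeCoeff (2 + m)
  b  = (2 * suc m) C suc (suc m)
  collect : ∀ m j c → (2 + m) * (2 * suc m * j) + 4 * (2 + m) * (suc m * c) ≡ 2 * suc m * (2 + m) * (j + 2 * c)
  collect = solve-∀
  expand₂ : ∀ m c d → 2 * suc m * (2 + m) * (c + d) ≡ 2 * suc m * ((2 + m) * c) + 2 * suc m * (2 + m) * d
  expand₂ = solve-∀
  regroup : ∀ m c d → 2 * suc m * ((4 * suc m + 6) * c) + 2 * suc m * (2 + m) * d
    ≡ 2 * (4 * m + 10) * (suc m * c) + 2 * suc m * (2 + m) * d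
  regroup = solve-∀
  balance : ∀ m c → 2 * (4 * m + 10) * ((4 * m + 6) * c) + 2 * suc m * (2 + m) * c
    ≡ 2 * c * (9 * m * m + 39 * m + 38) + 4 * (2 + m) * ((4 * m + 6) * c)
  balance = solve-∀

-- Boxes of the staircase encoding

<ᵇ-true : ∀ {m n} → m < n → (m <ᵇ n) ≡ true
<ᵇ-true {zero}  {suc n} _       = refl
<ᵇ-true {suc m} {suc n} (s≤s p) = <ᵇ-true p

<ᵇ-false : ∀ {m n} → n ≤ m → (m <ᵇ n) ≡ false
<ᵇ-false {m}     {zero}  _       = refl
<ᵇ-false {suc m} {suc n} (s≤s p) = <ᵇ-false p

<ᵇ-+ˡ : ∀ c m n → (c + m <ᵇ c + n) ≡ (m <ᵇ n)
<ᵇ-+ˡ zero    m n = refl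
<ᵇ-+ˡ (suc c) m n = <ᵇ-+ˡ c m n

at-++ˡ : ∀ xs ys {p} d → p < length xs → at (xs ++ ys) p d ≡ at xs p d
at-++ˡ (x ∷ xs) ys {zero}  d _       = refl
at-++ˡ (x ∷ xs) ys {suc p} d (s≤s l) = at-++ˡ xs ys d l

at-++ʳ : ∀ xs ys p d → at (xs ++ ys) (length xs + p) d ≡ at ys p d
at-++ʳ []       ys p d = refl
at-++ʳ (x ∷ xs) ys p d = at-++ʳ xs ys p d

at-map : ∀ f xs p d → at (map f xs) p (f d) ≡ f (at xs p d)
at-map f []       p       d = refl
at-map f (x ∷ xs) zero    d = refl
at-map f (x ∷ xs) (suc p) d = at-map f xs p d

at-default : ∀ xs {p} d d′ → p < length xs → at xs p d ≡ at xs p d′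
at-default (x ∷ xs) {zero}  d d′ _       = refl
at-default (x ∷ xs) {suc p} d d′ (s≤s l) = at-default xs d d′ l

at-∈ : ∀ xs {p} d → p < length xs → at xs p d ∈ xs
at-∈ (x ∷ xs) {zero}  d _       = here refl
at-∈ (x ∷ xs) {suc p} d (s≤s l) = there (at-∈ xs d l)

at-beyond : ∀ xs {p} d → length xs ≤ p → at xs p d ≡ d
at-beyond []       d _ = refl
at-beyond (x ∷ xs) {suc p} d (s≤s l) = at-beyond xs d l

-- The form of every filter in the definitions, so that boxes, minima and `J` unfold to `select` and
-- `count` directly.
select : ∀ {A : Set} → (A → Bool) → List A → List A
select f = filter (λ x → f x ≟ᵇ true)

count : ∀ {A : Set} → (A → Bool) → List A → ℕ
count f xs = length (select f xs)

module _ {A : Set} where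
  select-cong : ∀ {f g : A → Bool} xs → (∀ {x} → x ∈ xs → f x ≡ g x) → select f xs ≡ select g xs
  select-cong []       _ = refl
  select-cong {f} {g} (x ∷ xs) e with f x | g x | e (here refl)
  ... | true  | .true  | refl = cong (x ∷_) (select-cong xs (e ∘ there))
  ... | false | .false | refl = select-cong xs (e ∘ there)

  select-map : ∀ {B : Set} (f : A → Bool) (g : B → A) xs → select f (map g xs) ≡ map g (select (f ∘ g) xs)
  select-map f g []       = refl
  select-map f g (x ∷ xs) with f (g x)
  ... | true  = cong (g x ∷_) (select-map f g xs)
  ... | false = select-map f g xs

  count-cong : ∀ {f g : A → Bool} xs → (∀ {x} → x ∈ xs → f x ≡ g x) → count f xs ≡ count g xs
  count-cong xs e = cong length (select-cong xs e)

  count-map : ∀ {B : Set} (f : A → Bool) (g : B → A) xs → count f (map g xs) ≡ count (f ∘ g) xs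
  count-map f g xs = trans (cong length (select-map f g xs)) (length-map g (select (f ∘ g) xs))

  count-++ : ∀ (f : A → Bool) xs ys → count f (xs ++ ys) ≡ count f xs + count f ys
  count-++ f xs ys = trans (cong length (filter-++ (λ x → f x ≟ᵇ true) xs ys)) (length-++ (select f xs))

  count-false : ∀ (f : A → Bool) xs → (∀ {x} → x ∈ xs → f x ≡ false) → count f xs ≡ 0
  count-false f []       _ = refl
  count-false f (x ∷ xs) e with f x | e (here refl)
  ... | false | _ = count-false f xs (e ∘ there)

  all-cong : ∀ {f g : A → Bool} xs → (∀ {x} → x ∈ xs → f x ≡ g x) → all f xs ≡ all g xs
  all-cong []       _ = refl
  all-cong (x ∷ xs) e = cong₂ _∧_ (e (here refl)) (all-cong xs (e ∘ there))

  all-++ : ∀ (f : A → Bool) xs ys → all f (xs ++ ys) ≡ all f xs ∧ all f ys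
  all-++ f []       ys = refl
  all-++ f (x ∷ xs) ys with f x
  ... | true  = all-++ f xs ys
  ... | false = refl

  all-true : ∀ (f : A → Bool) xs → (∀ {x} → x ∈ xs → f x ≡ true) → all f xs ≡ true
  all-true f []       _ = refl
  all-true f (x ∷ xs) e rewrite e (here refl) = all-true f xs (e ∘ there)

  all-map : ∀ {B : Set} (f : A → Bool) (g : B → A) xs → all f (map g xs) ≡ all (f ∘ g) xs
  all-map f g []       = refl
  all-map f g (x ∷ xs) = cong (f (g x) ∧_) (all-map f g xs)

upTo-+ : ∀ m n → upTo (m + n) ≡ upTo m ++ map (m +_) (upTo n)
upTo-+ m n = go id m
  where
  go : ∀ (f : ℕ → ℕ) m → applyUpTo f (m + n) ≡ applyUpTo f m ++ map (λ k → f (m + k)) (upTo n)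
  go f zero    = sym (map-upTo f n)
  go f (suc m) = cong (f 0 ∷_) (go (f ∘ suc) m)

count-upTo-+ : ∀ f m n → count f (upTo (m + n)) ≡ count f (upTo m) + count (λ p → f (m + p)) (upTo n)
count-upTo-+ f m n = trans (cong (count f) (upTo-+ m n))
  (trans (count-++ f (upTo m) _) (cong (count f (upTo m) +_) (count-map f (m +_) (upTo n))))

indicator : Bool → ℕ
indicator true  = 1
indicator false = 0

columnCount : (ℕ → Bool) → ℕ → ℕ
columnCount g zero    = 0
columnCount g (suc m) = columnCount g m + indicator (g (suc m))

-- Counts the boxes (i, j) with 1 ≤ i ≤ j ≤ a by columns. The recursion removes the last column, the
-- only one that a new final maximum affects.
pairCount : (ℕ → ℕ → Bool) → ℕ → ℕ
pairCount f zero    = 0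
pairCount f (suc a) = pairCount f a + columnCount (λ i → f i (suc a)) (suc a)

count-singleton : ∀ {A : Set} (f : A → Bool) x → count f (x ∷ []) ≡ indicator (f x)
count-singleton f x with f x
... | true  = refl
... | false = refl

columnCount-correct : ∀ (g : ℕ → Bool) m → count g (applyUpTo suc m) ≡ columnCount g m
columnCount-correct g zero    = refl
columnCount-correct g (suc m) = begin
  count g (applyUpTo suc (suc m))                 ≡⟨ cong (count g) (applyUpTo-∷ʳ suc m) ⟨
  count g (applyUpTo suc m ∷ʳ suc m)              ≡⟨ count-++ g (applyUpTo suc m) _ ⟩
  count g (applyUpTo suc m) + count g [ suc m ]   ≡⟨ cong₂ _+_ (columnCount-correct g m) (count-singleton g (suc m)) ⟩
  columnCount g (suc m)                           ∎
  where open ≡-Reasoning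

pairCount-correct : ∀ (f : ℕ → ℕ → Bool) a →
  count (λ ij → f (proj₁ ij) (proj₂ ij))
    (concatMap (λ j → map (λ i → (i , j)) (applyUpTo suc j)) (applyUpTo suc a)) ≡ pairCount f a
pairCount-correct f zero    = refl
pairCount-correct f (suc a) = begin
  count F (concatMap column (applyUpTo suc (suc a)))
    ≡⟨ cong (count F ∘ concatMap column) (applyUpTo-∷ʳ suc a) ⟨
  count F (concatMap column (applyUpTo suc a ∷ʳ suc a))
    ≡⟨ cong (count F) (concatMap-++ column (applyUpTo suc a) [ suc a ]) ⟩
  count F (concatMap column (applyUpTo suc a) ++ (column (suc a) ++ []))
    ≡⟨ count-++ F (concatMap column (applyUpTo suc a)) _ ⟩
  count F (concatMap column (applyUpTo suc a)) + count F (column (suc a) ++ [])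
    ≡⟨ cong₂ _+_ (pairCount-correct f a) (trans (cong (count F) (++-identityʳ (column (suc a))))
         (trans (count-map F (λ i → (i , suc a)) (applyUpTo suc (suc a))) (columnCount-correct _ (suc a)))) ⟩
  pairCount f (suc a) ∎
  where
  open ≡-Reasoning
  F : ℕ × ℕ → Bool
  F ij = f (proj₁ ij) (proj₂ ij)
  column : ℕ → List (ℕ × ℕ)
  column j = map (λ i → (i , j)) (applyUpTo suc j)

columnCount-cong : ∀ {f g} m → (∀ i → i < m → f (suc i) ≡ g (suc i)) → columnCount f m ≡ columnCount g m
columnCount-cong zero    e = refl
columnCount-cong (suc m) e = cong₂ _+_ (columnCount-cong m (λ i l → e i (m<n⇒m<1+n l))) (cong indicator (e m ≤-refl))

pairCount-cong : ∀ {f g} a → (∀ i j → i ≤ j → j < a → f (suc i) (suc j) ≡ g (suc i) (suc j)) →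
                 pairCount f a ≡ pairCount g a
pairCount-cong zero    e = refl
pairCount-cong (suc a) e = cong₂ _+_ (pairCount-cong a (λ i j p l → e i j p (m<n⇒m<1+n l)))
  (columnCount-cong (suc a) (λ i l → e i a (s≤s⁻¹ l) ≤-refl))

columnCount-+ : ∀ g a b → columnCount g (a + b) ≡ columnCount g a + columnCount (g ∘ (a +_)) b
columnCount-+ g a zero    = trans (cong (columnCount g) (+-identityʳ a)) (sym (+-identityʳ _))
columnCount-+ g a (suc b) rewrite +-suc a b =
  trans (cong (_+ indicator (g (suc (a + b)))) (columnCount-+ g a b)) (+-assoc (columnCount g a) _ _)

columnCount-false : ∀ {g} m → (∀ i → i < m → g (suc i) ≡ false) → columnCount g m ≡ 0
columnCount-false zero    e = refl
columnCount-false {g} (suc m) e rewrite e m ≤-refl =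
  trans (+-identityʳ _) (columnCount-false m (λ i l → e i (m<n⇒m<1+n l)))

-- If the block of rows up to a and columns beyond a is empty, two smaller staircases along the
-- diagonal remain.
pairCount-+ : ∀ f a b → (∀ i j → i < a → j < b → f (suc i) (a + suc j) ≡ false) →
              pairCount f (a + b) ≡ pairCount f a + pairCount (λ i j → f (a + i) (a + j)) b
pairCount-+ f a zero    e = trans (cong (pairCount f) (+-identityʳ a)) (sym (+-identityʳ _))
pairCount-+ f a (suc b) e = begin
  pairCount f (a + suc b)
    ≡⟨ cong (pairCount f) (+-suc a b) ⟩
  pairCount f (a + b) + columnCount (λ i → f i (suc (a + b))) (suc (a + b))
    ≡⟨ cong (λ k → pairCount f (a + b) + columnCount (λ i → f i k) k) (+-suc a b) ⟨
  pairCount f (a + b) + columnCount (λ i → f i (a + suc b)) (a + suc b)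
    ≡⟨ cong₂ _+_ (pairCount-+ f a b (λ i j p l → e i j p (m<n⇒m<1+n l)))
         (trans (columnCount-+ (λ i → f i (a + suc b)) a (suc b))
                (cong (_+ columnCount (λ i → f (a + i) (a + suc b)) (suc b))
                      (columnCount-false a (λ i l → e i b l ≤-refl)))) ⟩
  pairCount f a + pairCount (λ i j → f (a + i) (a + j)) b + columnCount (λ i → f (a + i) (a + suc b)) (suc b)
    ≡⟨ +-assoc (pairCount f a) _ _ ⟩
  pairCount f a + pairCount (λ i j → f (a + i) (a + j)) (suc b) ∎
  where open ≡-Reasoning

nonzeroBoxes-pairCount : ∀ π → nonzeroBoxes π ≡ pairCount (λ i j → 0 <ᵇ box π i j) (length (lrMinPositions π))
nonzeroBoxes-pairCount π = pairCount-correct (λ i j → 0 <ᵇ box π i j) (length (lrMinPositions π))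

-- Skew sums

infixr 5 _⊖_
_⊖_ : List ℕ → List ℕ → List ℕ
α ⊖ β = map (length β +_) α ++ β

isLRMin : List ℕ → ℕ → Bool
isLRMin π p = all (λ q → at π p 0 <ᵇ at π q 0) (upTo p)

minima-bounded : ∀ π {p} → p ∈ lrMinPositions π → p < length π
minima-bounded π p∈ = ∈-upTo⁻ (proj₁ (∈-filter⁻ (λ p → isLRMin π p ≟ᵇ true) {xs = upTo (length π)} p∈))

kpos-≤ : ∀ π j → kpos π j ≤ length π
kpos-≤ π j with j ∸ 1 <? length (lrMinPositions π)
... | yes l = <⇒≤ (minima-bounded π (at-∈ (lrMinPositions π) (length π) l))
... | no ¬l = ≤-reflexive (at-beyond (lrMinPositions π) (length π) (≮⇒≥ ¬l))

kpos-< : ∀ π j → j < length (lrMinPositions π) → kpos π (suc j) < length π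
kpos-< π j l = minima-bounded π (at-∈ (lrMinPositions π) (length π) l)

-- Position 0 always holds a minimum; for the empty list the default value, its length, is 0 as
-- well.
kpos-first : ∀ π → kpos π 1 ≡ 0
kpos-first []      = refl
kpos-first (x ∷ π) = refl

-- The test inside `box` with the four bounds as parameters, so that one violated bound refutes it
-- whatever the others are.
inBox : (lo hi vlo vhi : ℕ) → List ℕ → ℕ → Bool
inBox lo hi vlo vhi π p = (lo <ᵇ p) ∧ (p <ᵇ hi) ∧ (vlo <ᵇ at π p 0) ∧ (at π p 0 <ᵇ vhi)

inBox-lo : ∀ {lo} hi vlo vhi π {p} → p ≤ lo → inBox lo hi vlo vhi π p ≡ false
inBox-lo hi vlo vhi π l rewrite <ᵇ-false l = refl

inBox-hi : ∀ lo {hi} vlo vhi π {p} → hi ≤ p → inBox lo hi vlo vhi π p ≡ false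
inBox-hi lo vlo vhi π {p} l rewrite <ᵇ-false l = ∧-zeroʳ (lo <ᵇ p)

inBox-vlo : ∀ lo hi {vlo} vhi π {p} → at π p 0 ≤ vlo → inBox lo hi vlo vhi π p ≡ false
inBox-vlo lo hi vhi π {p} l rewrite <ᵇ-false l =
  trans (cong ((lo <ᵇ p) ∧_) (∧-zeroʳ (p <ᵇ hi))) (∧-zeroʳ (lo <ᵇ p))

module SkewSum (α β : List ℕ) (β< : All (_< length β) β) where
  a = length α
  b = length β
  π = α ⊖ β
  shifted = map (b +_) α
  ka = length (lrMinPositions α)

  length-shifted : length shifted ≡ a
  length-shifted = length-map (b +_) α

  length-π : length π ≡ a + b
  length-π = trans (length-++ shifted) (cong (_+ b) length-shifted)

  at-left : ∀ {p} → p < a → at π p 0 ≡ b + at α p 0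
  at-left {p} l = begin
    at π p 0               ≡⟨ at-++ˡ shifted β 0 l′ ⟩
    at shifted p 0         ≡⟨ at-default shifted 0 (b + 0) l′ ⟩
    at shifted p (b + 0)   ≡⟨ at-map (b +_) α p 0 ⟩
    b + at α p 0           ∎
    where
    open ≡-Reasoning
    l′ : p < length shifted
    l′ = subst (p <_) (sym length-shifted) l

  at-right : ∀ p → at π (a + p) 0 ≡ at β p 0
  at-right p = trans (cong (λ k → at π (k + p) 0) (sym length-shifted)) (at-++ʳ shifted β p 0)

  at-right-< : ∀ {p} → p < b → at π (a + p) 0 < b
  at-right-< {p} l = subst (_< b) (sym (at-right p)) (All.lookup β< (at-∈ β 0 l))

  isLRMin-left : ∀ {p} → p < a → isLRMin π p ≡ isLRMin α p
  isLRMin-left {p} l = all-cong (upTo p) λ {q} q∈ →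
    trans (cong₂ _<ᵇ_ (at-left l) (at-left (<-trans (∈-upTo⁻ q∈) l))) (<ᵇ-+ˡ b _ _)

  -- Shifted entries of α are at least b and entries of β are below b, so the comparisons with α all
  -- succeed.
  isLRMin-right : ∀ {p} → p < b → isLRMin π (a + p) ≡ isLRMin β p
  isLRMin-right {p} l = begin
    all f (upTo (a + p))                             ≡⟨ cong (all f) (upTo-+ a p) ⟩
    all f (upTo a ++ map (a +_) (upTo p))            ≡⟨ all-++ f (upTo a) _ ⟩
    all f (upTo a) ∧ all f (map (a +_) (upTo p))     ≡⟨ cong₂ _∧_ (all-true f (upTo a) above) (all-map f (a +_) (upTo p)) ⟩
    all (f ∘ (a +_)) (upTo p)                        ≡⟨ all-cong (upTo p) (λ {q} _ → cong₂ _<ᵇ_ (at-right p) (at-right q)) ⟩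
    isLRMin β p                                      ∎
    where
    open ≡-Reasoning
    f : ℕ → Bool
    f q = at π (a + p) 0 <ᵇ at π q 0
    above : ∀ {q} → q ∈ upTo a → f q ≡ true
    above {q} q∈ = <ᵇ-true (<-≤-trans (at-right-< l) (subst (b ≤_) (sym (at-left (∈-upTo⁻ q∈))) (m≤m+n b _)))

  minima : lrMinPositions π ≡ lrMinPositions α ++ map (a +_) (lrMinPositions β)
  minima = begin
    select (isLRMin π) (upTo (length π))
      ≡⟨ cong (select (isLRMin π)) (trans (cong upTo length-π) (upTo-+ a b)) ⟩
    select (isLRMin π) (upTo a ++ map (a +_) (upTo b))
      ≡⟨ filter-++ (λ p → isLRMin π p ≟ᵇ true) (upTo a) _ ⟩
    select (isLRMin π) (upTo a) ++ select (isLRMin π) (map (a +_) (upTo b))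
      ≡⟨ cong₂ _++_ (select-cong (upTo a) (isLRMin-left ∘ ∈-upTo⁻))
           (trans (select-map (isLRMin π) (a +_) (upTo b))
                  (cong (map (a +_)) (select-cong (upTo b) (isLRMin-right ∘ ∈-upTo⁻)))) ⟩
    lrMinPositions α ++ map (a +_) (lrMinPositions β) ∎
    where open ≡-Reasoning

  length-minima : length (lrMinPositions π) ≡ ka + length (lrMinPositions β)
  length-minima = trans (cong length minima)
    (trans (length-++ (lrMinPositions α)) (cong (ka +_) (length-map (a +_) (lrMinPositions β))))

  kpos-right : ∀ j → kpos π (ka + suc j) ≡ a + kpos β (suc j)
  kpos-right j = begin
    at (lrMinPositions π) (ka + suc j ∸ 1) (length π)
      ≡⟨ cong₂ (λ k d → at (lrMinPositions π) k d) (cong (_∸ 1) (+-suc ka j)) length-π ⟩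
    at (lrMinPositions π) (ka + j) (a + b)
      ≡⟨ cong (λ ks → at ks (ka + j) (a + b)) minima ⟩
    at (lrMinPositions α ++ map (a +_) (lrMinPositions β)) (ka + j) (a + b)
      ≡⟨ at-++ʳ (lrMinPositions α) _ j (a + b) ⟩
    at (map (a +_) (lrMinPositions β)) j (a + b)
      ≡⟨ at-map (a +_) (lrMinPositions β) j b ⟩
    a + kpos β (suc j) ∎
    where open ≡-Reasoning

  -- The case j = `ka` is the right end of the last column of α: in α the default value a, in π the
  -- first position of β (or the end, if β is empty), which is a too.
  kpos-left : ∀ j → j ≤ ka → kpos π (suc j) ≡ kpos α (suc j)
  kpos-left j l with m≤n⇒m<n∨m≡n l
  ... | inj₁ j<ka = begin
    at (lrMinPositions π) j (length π)       ≡⟨ cong (λ ks → at ks j (length π)) minima ⟩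
    at (lrMinPositions α ++ _) j (length π)  ≡⟨ at-++ˡ (lrMinPositions α) _ (length π) j<ka ⟩
    at (lrMinPositions α) j (length π)       ≡⟨ at-default (lrMinPositions α) (length π) a j<ka ⟩
    at (lrMinPositions α) j a                ∎
    where open ≡-Reasoning
  ... | inj₂ refl = begin
    kpos π (suc ka)       ≡⟨ cong (kpos π) (trans (cong suc (sym (+-identityʳ ka))) (sym (+-suc ka 0))) ⟩
    kpos π (ka + 1)       ≡⟨ kpos-right 0 ⟩
    a + kpos β 1          ≡⟨ cong (a +_) (kpos-first β) ⟩
    a + 0                 ≡⟨ +-identityʳ a ⟩
    a                     ≡⟨ at-beyond (lrMinPositions α) a ≤-refl ⟨
    kpos α (suc ka)       ∎
    where open ≡-Reasoning

  kval-left : ∀ i → i ≤ ka → kval π i ≡ b + kval α i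
  kval-left zero    l = trans length-π (+-comm a b)
  kval-left (suc i) l = trans (cong (λ p → at π p 0) (kpos-left i (<⇒≤ l))) (at-left (kpos-< α i l))

  kval-right : ∀ i → kval π (ka + suc i) ≡ kval β (suc i)
  kval-right i = begin
    kval π (ka + suc i)                ≡⟨ cong (kval π) (+-suc ka i) ⟩
    at π (kpos π (suc (ka + i))) 0     ≡⟨ cong (λ j → at π (kpos π j) 0) (+-suc ka i) ⟨
    at π (kpos π (ka + suc i)) 0       ≡⟨ cong (λ p → at π p 0) (kpos-right i) ⟩
    at π (a + kpos β (suc i)) 0        ≡⟨ at-right (kpos β (suc i)) ⟩
    kval β (suc i)                     ∎
    where open ≡-Reasoning

  cell : ℕ → ℕ → ℕ → Bool
  cell i j = inBox (kpos π j) (kpos π (suc j)) (kval π i) (kval π (i ∸ 1)) π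

  box-split : ∀ i j → box π i j ≡ count (cell i j) (upTo a) + count (λ p → cell i j (a + p)) (upTo b)
  box-split i j = trans (cong (λ n → count (cell i j) (upTo n)) length-π) (count-upTo-+ (cell i j) a b)

  box-left : ∀ i j → i ≤ j → j < ka → box π (suc i) (suc j) ≡ box α (suc i) (suc j)
  box-left i j i≤j j<ka = trans (box-split (suc i) (suc j)) (trans (cong₂ _+_ left right) (+-identityʳ _))
    where
    left : count (cell (suc i) (suc j)) (upTo a) ≡ box α (suc i) (suc j)
    left = count-cong (upTo a) λ {p} p∈ → cong₂ _∧_
      (cong (_<ᵇ p) (kpos-left j (<⇒≤ j<ka)))
      (cong₂ _∧_ (cong (p <ᵇ_) (kpos-left (suc j) j<ka))
        (cong₂ _∧_
          (trans (cong₂ _<ᵇ_ (kval-left (suc i) (≤-<-trans i≤j j<ka)) (at-left (∈-upTo⁻ p∈))) (<ᵇ-+ˡ b _ _))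
          (trans (cong₂ _<ᵇ_ (at-left (∈-upTo⁻ p∈)) (kval-left i (≤-trans i≤j (<⇒≤ j<ka)))) (<ᵇ-+ˡ b _ _))))
    right : count (λ p → cell (suc i) (suc j) (a + p)) (upTo b) ≡ 0
    right = count-false _ (upTo b) λ {p} _ → inBox-hi (kpos π (suc j)) (kval π (suc i)) (kval π i) π
      (≤-trans (≤-reflexive (kpos-left (suc j) j<ka)) (≤-trans (kpos-≤ α (2 + j)) (m≤m+n a p)))

  column-right-left : ∀ i j {p} → p < a → cell i (ka + suc j) p ≡ false
  column-right-left i j {p} l = inBox-lo (kpos π (suc (ka + suc j))) (kval π i) (kval π (i ∸ 1)) π
    (≤-trans (<⇒≤ l) (subst (a ≤_) (sym (kpos-right j)) (m≤m+n a _)))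

  -- A column of β holds only entries below b, whereas a row of α begins at b or higher.
  box-mixed : ∀ i j → i < ka → box π (suc i) (ka + suc j) ≡ 0
  box-mixed i j l = trans (box-split (suc i) (ka + suc j)) (cong₂ _+_
    (count-false _ (upTo a) (column-right-left (suc i) j ∘ ∈-upTo⁻))
    (count-false _ (upTo b) λ {p} p∈ → inBox-vlo (kpos π (ka + suc j)) (kpos π (suc (ka + suc j))) (kval π i) π
      (≤-trans (<⇒≤ (at-right-< (∈-upTo⁻ p∈))) (subst (b ≤_) (sym (kval-left (suc i) l)) (m≤m+n b _)))))

  box-right : ∀ i j → box π (ka + suc i) (ka + suc j) ≡ box β (suc i) (suc j)
  box-right i j = trans (box-split (ka + suc i) (ka + suc j)) (cong₂ _+_
    (count-false _ (upTo a) (column-right-left (ka + suc i) j ∘ ∈-upTo⁻))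
    (count-cong (upTo b) λ {p} p∈ → cong₂ _∧_
      (trans (cong (_<ᵇ a + p) (kpos-right j)) (<ᵇ-+ˡ a _ p))
      (cong₂ _∧_ (trans (cong (a + p <ᵇ_) (trans (cong (kpos π) (sym (+-suc ka (suc j)))) (kpos-right (suc j)))) (<ᵇ-+ˡ a p _))
        (cong₂ _∧_ (cong₂ _<ᵇ_ (kval-right i) (at-right p)) (top i (∈-upTo⁻ p∈))))))
    where
    top : ∀ i {p} → p < b → (at π (a + p) 0 <ᵇ kval π (ka + suc i ∸ 1)) ≡ (at β p 0 <ᵇ kval β i)
    -- In π the top row of β is bounded above by the last minimum of α (or by the size, if α is
    -- empty), in β by b. Both bounds exceed every entry of β.
    top zero {p} l = trans
      (<ᵇ-true (<-≤-trans (at-right-< l) (subst (b ≤_)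
        (sym (trans (cong (λ k → kval π (k ∸ 1)) (+-comm ka 1)) (kval-left ka ≤-refl))) (m≤m+n b _))))
      (sym (<ᵇ-true (All.lookup β< (at-∈ β 0 l))))
    top (suc i) {p} l = cong₂ _<ᵇ_ (at-right p)
      (trans (cong (λ k → kval π (k ∸ 1)) (+-suc ka (suc i))) (kval-right i))

  nonzeroBoxes-⊖ : nonzeroBoxes π ≡ nonzeroBoxes α + nonzeroBoxes β
  nonzeroBoxes-⊖ = begin
    nonzeroBoxes π
      ≡⟨ nonzeroBoxes-pairCount π ⟩
    pairCount f (length (lrMinPositions π))
      ≡⟨ cong (pairCount f) length-minima ⟩
    pairCount f (ka + kb)
      ≡⟨ pairCount-+ f ka kb (λ i j l _ → cong (0 <ᵇ_) (box-mixed i j l)) ⟩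
    pairCount f ka + pairCount (λ i j → f (ka + i) (ka + j)) kb
      ≡⟨ cong₂ _+_ (pairCount-cong ka (λ i j l l′ → cong (0 <ᵇ_) (box-left i j l l′)))
                   (pairCount-cong kb (λ i j _ _ → cong (0 <ᵇ_) (box-right i j))) ⟩
    pairCount (λ i j → 0 <ᵇ box α i j) ka + pairCount (λ i j → 0 <ᵇ box β i j) kb
      ≡⟨ cong₂ _+_ (nonzeroBoxes-pairCount α) (nonzeroBoxes-pairCount β) ⟨
    nonzeroBoxes α + nonzeroBoxes β ∎
    where
    open ≡-Reasoning
    kb = length (lrMinPositions β)
    f : ℕ → ℕ → Bool
    f i j = 0 <ᵇ box π i j

-- Appending a new maximum

appendMax : List ℕ → List ℕ
appendMax α = α ++ [ length α ]

topRightNonempty : List ℕ → Bool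
topRightNonempty π = 0 <ᵇ box π 1 (length (lrMinPositions π))

≡ᵇ-refl : ∀ n → (n ≡ᵇ n) ≡ true
≡ᵇ-refl zero    = refl
≡ᵇ-refl (suc n) = ≡ᵇ-refl n

<⇒≡ᵇ-false : ∀ {m n} → m < n → (m ≡ᵇ n) ≡ false
<⇒≡ᵇ-false {zero}  {suc n} _       = refl
<⇒≡ᵇ-false {suc m} {suc n} (s≤s l) = <⇒≡ᵇ-false l

length-appendMax : ∀ α → length (appendMax α) ≡ suc (length α)
length-appendMax α = trans (length-++ α) (+-comm (length α) 1)

module AppendMax (x : ℕ) (α′ : List ℕ) (α< : All (_< suc (length α′)) (x ∷ α′)) where
  α = x ∷ α′
  a = length α
  π = appendMax α
  ka = length (lrMinPositions α)

  at-old : ∀ {p} → p < a → at π p 0 ≡ at α p 0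
  at-old = at-++ˡ α [ a ] 0

  at-old-< : ∀ {p} → p < a → at π p 0 < a
  at-old-< l = subst (_< a) (sym (at-old l)) (All.lookup α< (at-∈ α 0 l))

  at-new : at π a 0 ≡ a
  at-new = trans (cong (λ p → at π p 0) (sym (+-identityʳ a))) (at-++ʳ α [ a ] 0 0)

  minima : lrMinPositions π ≡ lrMinPositions α
  minima = begin
    select (isLRMin π) (upTo (length π))
      ≡⟨ cong (select (isLRMin π)) (trans (cong upTo (length-appendMax α)) (sym (upTo-∷ʳ a))) ⟩
    select (isLRMin π) (upTo a ∷ʳ a)
      ≡⟨ filter-++ (λ p → isLRMin π p ≟ᵇ true) (upTo a) [ a ] ⟩
    select (isLRMin π) (upTo a) ++ select (isLRMin π) [ a ]
      ≡⟨ cong₂ _++_ (select-cong (upTo a) (λ p∈ → all-cong (upTo _) (λ q∈ →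
           cong₂ _<ᵇ_ (at-old (∈-upTo⁻ p∈)) (at-old (<-trans (∈-upTo⁻ q∈) (∈-upTo⁻ p∈))))))
           not-last ⟩
    lrMinPositions α ++ []
      ≡⟨ ++-identityʳ (lrMinPositions α) ⟩
    lrMinPositions α ∎
    where
    open ≡-Reasoning
    not-last : select (isLRMin π) [ a ] ≡ []
    not-last rewrite <ᵇ-false (≤-trans (<⇒≤ (at-old-< {0} z<s)) (≤-reflexive (sym at-new))) = refl

  length-minima : length (lrMinPositions π) ≡ ka
  length-minima = cong length minima

  kpos-old : ∀ j → j < ka → kpos π (suc j) ≡ kpos α (suc j)
  kpos-old j l = trans (cong (λ ks → at ks j (length π)) minima) (at-default (lrMinPositions α) (length π) a l)

  kpos-end : kpos π (suc ka) ≡ suc a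
  kpos-end = trans (at-beyond (lrMinPositions π) (length π) (≤-reflexive length-minima)) (length-appendMax α)

  kpos-end-α : kpos α (suc ka) ≡ a
  kpos-end-α = at-beyond (lrMinPositions α) a ≤-refl

  kval-old : ∀ i → i < ka → kval π (suc i) ≡ kval α (suc i)
  kval-old i l = trans (cong (λ p → at π p 0) (kpos-old i l)) (at-old (kpos-< α i l))

  kval-old-< : ∀ i → i < ka → kval π (suc i) < a
  kval-old-< i l = subst (_< a) (sym (cong (λ p → at π p 0) (kpos-old i l))) (at-old-< (kpos-< α i l))

  -- The new entry lies above all minima and after all positions, so it falls into the top right box
  -- alone. The ends of the last column and of the top row move from a to a + 1, which old entries
  -- do not notice.
  box-appendMax : ∀ i j → i ≤ j → j < ka →
    box π (suc i) (suc j) ≡ box α (suc i) (suc j) + indicator ((i ≡ᵇ 0) ∧ (suc j ≡ᵇ ka))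
  box-appendMax i j i≤j j<ka = begin
    count cell (upTo (length π))
      ≡⟨ cong (count cell) (trans (cong upTo (length-appendMax α)) (sym (upTo-∷ʳ a))) ⟩
    count cell (upTo a ∷ʳ a)
      ≡⟨ count-++ cell (upTo a) [ a ] ⟩
    count cell (upTo a) + count cell [ a ]
      ≡⟨ cong₂ _+_ (count-cong (upTo a) (old ∘ ∈-upTo⁻)) (trans (count-singleton cell a) (cong indicator new)) ⟩
    box α (suc i) (suc j) + indicator ((i ≡ᵇ 0) ∧ (suc j ≡ᵇ ka)) ∎
    where
    open ≡-Reasoning
    cell : ℕ → Bool
    cell = inBox (kpos π (suc j)) (kpos π (2 + j)) (kval π (suc i)) (kval π i) π
    i<ka : i < ka
    i<ka = ≤-<-trans i≤j j<ka
    column-end : ∀ {p} → p < a → (p <ᵇ kpos π (2 + j)) ≡ (p <ᵇ kpos α (2 + j))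
    column-end {p} l with m≤n⇒m<n∨m≡n j<ka
    ... | inj₁ 1+j<ka = cong (p <ᵇ_) (kpos-old (suc j) 1+j<ka)
    ... | inj₂ e = trans (<ᵇ-true (subst (p <_) (sym (trans (cong (kpos π ∘ suc) e) kpos-end)) (m<n⇒m<1+n l)))
                         (sym (<ᵇ-true (subst (p <_) (sym (trans (cong (kpos α ∘ suc) e) kpos-end-α)) l)))
    row-top : ∀ i {p} → i < ka → p < a → (at π p 0 <ᵇ kval π i) ≡ (at α p 0 <ᵇ kval α i)
    row-top zero    {p} _ l = trans (<ᵇ-true (subst (at π p 0 <_) (sym (length-appendMax α)) (m<n⇒m<1+n (at-old-< l))))
                                    (sym (<ᵇ-true (All.lookup α< (at-∈ α 0 l))))
    row-top (suc i) {p} i<ka l = cong₂ _<ᵇ_ (at-old l) (kval-old i (<⇒≤ i<ka))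
    old : ∀ {p} → p < a → cell p ≡ inBox (kpos α (suc j)) (kpos α (2 + j)) (kval α (suc i)) (kval α i) α p
    old {p} l = cong₂ _∧_ (cong (_<ᵇ p) (kpos-old j j<ka))
      (cong₂ _∧_ (column-end l)
        (cong₂ _∧_ (cong₂ _<ᵇ_ (kval-old i i<ka) (at-old l)) (row-top i i<ka l)))
    top-row : ∀ i → i < ka → (at π a 0 <ᵇ kval π i) ≡ (i ≡ᵇ 0)
    top-row zero    l = <ᵇ-true (≤-reflexive (trans (cong suc at-new) (sym (length-appendMax α))))
    top-row (suc i) l = <ᵇ-false (≤-trans (<⇒≤ (kval-old-< i (<⇒≤ l))) (≤-reflexive (sym at-new)))
    last-column : (a <ᵇ kpos π (2 + j)) ≡ (suc j ≡ᵇ ka)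
    last-column with m≤n⇒m<n∨m≡n j<ka
    ... | inj₁ l = trans (<ᵇ-false (subst (_≤ a) (sym (kpos-old (suc j) l)) (kpos-≤ α (2 + j)))) (sym (<⇒≡ᵇ-false l))
    ... | inj₂ e = trans (<ᵇ-true (subst (a <_) (sym (trans (cong (kpos π ∘ suc) e) kpos-end)) ≤-refl))
                         (sym (trans (cong (_≡ᵇ ka) e) (≡ᵇ-refl ka)))
    new : cell a ≡ (i ≡ᵇ 0) ∧ (suc j ≡ᵇ ka)
    new rewrite <ᵇ-true (subst (_< a) (sym (kpos-old j j<ka)) (kpos-< α j j<ka))
              | <ᵇ-true (subst (kval π (suc i) <_) (sym at-new) (kval-old-< i i<ka))
              | last-column | top-row i i<ka = ∧-comm (suc j ≡ᵇ ka) (i ≡ᵇ 0)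

  corner-nonempty : (0 <ᵇ box π 1 ka) ≡ true
  corner-nonempty = <ᵇ-true (subst (0 <_) (sym (trans (box-appendMax 0 (ka ∸ 1) z≤n ≤-refl)
    (cong (λ b → box α 1 ka + indicator b) (≡ᵇ-refl ka)))) (≤-trans (s≤s z≤n) (m≤n+m 1 (box α 1 ka))))

  topRight : topRightNonempty π ≡ true
  topRight = trans (cong (λ k → 0 <ᵇ box π 1 k) length-minima) corner-nonempty

  nonzeroBoxes-appendMax : nonzeroBoxes π ≡ nonzeroBoxes α + indicator (not (topRightNonempty α))
  nonzeroBoxes-appendMax = begin
    nonzeroBoxes π
      ≡⟨ nonzeroBoxes-pairCount π ⟩
    pairCount f (length (lrMinPositions π))
      ≡⟨ cong (pairCount f) length-minima ⟩
    pairCount f k + columnCount (λ i → f i ka) ka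
      -- Row 1 is split off the last column, since box (1, `ka`) is the only one that can change.
      ≡⟨ cong₂ _+_ (pairCount-cong k earlier) (columnCount-+ (λ i → f i ka) 1 k) ⟩
    pairCount g k + (indicator (f 1 ka) + columnCount (λ i → f (suc i) ka) k)
      ≡⟨ cong (pairCount g k +_) (cong₂ _+_ topmost (columnCount-cong k below)) ⟩
    pairCount g k + (indicator (g 1 ka) + indicator (not (g 1 ka)) + columnCount (λ i → g (suc i) ka) k)
      ≡⟨ rearrange (pairCount g k) (indicator (g 1 ka)) _ _ ⟩
    pairCount g k + (indicator (g 1 ka) + columnCount (λ i → g (suc i) ka) k) + indicator (not (g 1 ka))
      ≡⟨ cong (λ z → pairCount g k + z + indicator (not (g 1 ka))) (columnCount-+ (λ i → g i ka) 1 k) ⟨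
    pairCount g ka + indicator (not (g 1 ka))
      ≡⟨ cong (_+ indicator (not (g 1 ka))) (nonzeroBoxes-pairCount α) ⟨
    nonzeroBoxes α + indicator (not (g 1 ka)) ∎
    where
    open ≡-Reasoning
    k = ka ∸ 1
    f g : ℕ → ℕ → Bool
    f i j = 0 <ᵇ box π i j
    g i j = 0 <ᵇ box α i j
    earlier : ∀ i j → i ≤ j → j < k → f (suc i) (suc j) ≡ g (suc i) (suc j)
    earlier i j l l′ = cong (0 <ᵇ_) (trans (box-appendMax i j l (s≤s (<⇒≤ l′)))
      (trans (cong (λ b → box α (suc i) (suc j) + indicator b)
                   (trans (cong ((i ≡ᵇ 0) ∧_) (<⇒≡ᵇ-false (s≤s l′))) (∧-zeroʳ (i ≡ᵇ 0))))
             (+-identityʳ _)))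
    below : ∀ i → i < k → f (2 + i) ka ≡ g (2 + i) ka
    below i l = cong (0 <ᵇ_) (trans (box-appendMax (suc i) k l ≤-refl) (+-identityʳ _))
    topmost : indicator (f 1 ka) ≡ indicator (g 1 ka) + indicator (not (g 1 ka))
    topmost = trans (cong indicator corner-nonempty) (sym (one (g 1 ka)))
      where
      one : ∀ b → indicator b + indicator (not b) ≡ 1
      one true  = refl
      one false = refl
    rearrange : ∀ p q r s → p + (q + r + s) ≡ p + (q + s) + r
    rearrange = solve-∀

-- Decomposition of 132-avoiding permutations

glue : List ℕ → List ℕ → List ℕ
glue α β = appendMax α ⊖ β

length-⊖ : ∀ α β → length (α ⊖ β) ≡ length α + length β
length-⊖ α β = trans (length-++ (map (length β +_) α)) (cong (_+ length β) (length-map _ α))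

length-glue : ∀ α β → length (glue α β) ≡ suc (length α + length β)
length-glue α β = trans (length-⊖ (appendMax α) β) (cong (_+ length β) (length-appendMax α))

⊖-identityʳ : ∀ α → α ⊖ [] ≡ α
⊖-identityʳ α = trans (++-identityʳ _) (map-id α)

-- For empty α the maximum becomes a left-to-right minimum and fills no box, although
-- `topRightNonempty []` is false; hence the separate case.
newBox : List ℕ → Bool
newBox []          = false
newBox α@(_ ∷ _) = not (topRightNonempty α)

nonzeroBoxes-glue : ∀ α β → All (_< length α) α → All (_< length β) β →
  nonzeroBoxes (glue α β) ≡ nonzeroBoxes α + indicator (newBox α) + nonzeroBoxes β
nonzeroBoxes-glue α β α< β< = trans (SkewSum.nonzeroBoxes-⊖ (appendMax α) β β<)
  (cong (_+ nonzeroBoxes β) (extend α α<))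
  where
  extend : ∀ α → All (_< length α) α → nonzeroBoxes (appendMax α) ≡ nonzeroBoxes α + indicator (newBox α)
  extend []      _  = refl
  extend (x ∷ α) α< = AppendMax.nonzeroBoxes-appendMax x α α<

topRight-glue-[] : ∀ α → All (_< length α) α → topRightNonempty (glue α []) ≡ not (null α)
topRight-glue-[] α α< = trans (cong topRightNonempty (⊖-identityʳ (appendMax α))) (last α α<)
  where
  last : ∀ α → All (_< length α) α → topRightNonempty (appendMax α) ≡ not (null α)
  last []      _  = refl
  last (x ∷ α) α< = AppendMax.topRight x α α<

-- The last column belongs to the nonempty right part and the first row to `appendMax α`, so the
-- corner is a mixed box.
topRight-glue-∷ : ∀ α y β → All (_< length (y ∷ β)) (y ∷ β) → topRightNonempty (glue α (y ∷ β)) ≡ false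
topRight-glue-∷ α y β β< = trans (cong (λ k → 0 <ᵇ box (glue α (y ∷ β)) 1 k) length-minima)
  (cong (0 <ᵇ_) (box-mixed 0 _ (nonempty α)))
  where
  open SkewSum (appendMax α) (y ∷ β) β<
  nonempty : ∀ α → 0 < length (lrMinPositions (appendMax α))
  nonempty []      = z<s
  nonempty (x ∷ α) = z<s

Avoids132 : List ℕ → Set
Avoids132 π = ∀ {p q r} → p < q → q < r → r < length π → at π p 0 < at π r 0 → ¬ at π r 0 < at π q 0

record Avoider (π : List ℕ) : Set where
  constructor avoider
  field
    bounded : All (_< length π) π
    unique  : Unique π
    avoids  : Avoids132 π
open Avoider

-- Being last, the maximum could only play the 2 of a 132, which calls for a larger entry.
appendMax-avoider : ∀ {α} → Avoider α → Avoider (appendMax α)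
appendMax-avoider {α} A = avoider
  (subst (λ n → All (_< n) (appendMax α)) (sym (length-appendMax α))
    (All.++⁺ (All.map m<n⇒m<1+n (bounded A)) (≤-refl ∷ [])))
  (Unique.++⁺ (unique A) ([] ∷ []) (λ { (x∈ , here refl) → <-irrefl refl (All.lookup (bounded A) x∈) }))
  avoid
  where
  a = length α
  avoid : Avoids132 (appendMax α)
  avoid {p} {q} {r} p<q q<r r< pr rq with m≤n⇒m<n∨m≡n (s≤s⁻¹ (subst (r <_) (length-appendMax α) r<))
  ... | inj₁ r<a = avoids A p<q q<r r<a
    (subst₂ _<_ (old (<-trans p<q (<-trans q<r r<a))) (old r<a) pr)
    (subst₂ _<_ (old r<a) (old (<-trans q<r r<a)) rq)
    where
    old : ∀ {k} → k < a → at (appendMax α) k 0 ≡ at α k 0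
    old = at-++ˡ α [ a ] 0
  ... | inj₂ refl = <-asym (subst₂ _<_
    (trans (cong (λ k → at (appendMax α) k 0) (sym (+-identityʳ a))) (at-++ʳ α [ a ] 0 0))
    (at-++ˡ α [ a ] 0 q<r) rq) (All.lookup (bounded A) (at-∈ α 0 q<r))

-- In a 132 the last entry exceeds the first, whereas every entry of β is below every shifted entry
-- of α; so the pattern lies within one summand.
⊖-avoider : ∀ {α β} → Avoider α → Avoider β → Avoider (α ⊖ β)
⊖-avoider {α} {β} A B = avoider
  (subst (λ n → All (_< n) (α ⊖ β)) (sym length-π)
    (All.++⁺ (All.map⁺ (All.map (λ {x} l → subst (b + x <_) (+-comm b a) (+-monoʳ-< b l)) (bounded A)))
             (All.map (λ l → <-≤-trans l (m≤n+m b a)) (bounded B))))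
  (Unique.++⁺ (Unique.map⁺ (+-cancelˡ-≡ b _ _) (unique A)) (unique B) disjoint)
  avoid
  where
  open SkewSum α β (bounded B)
  disjoint : ∀ {x} → ¬ (x ∈ shifted × x ∈ β)
  disjoint (x∈ , x∈β) with ∈-map⁻ (b +_) x∈
  ... | x , _ , refl = <⇒≱ (All.lookup (bounded B) x∈β) (m≤m+n b x)
  avoid : Avoids132 π
  avoid {p} {q} {r} p<q q<r r< pr rq with r <? a
  ... | yes r<a = avoids A p<q q<r r<a
    (+-cancelˡ-< b _ _ (subst₂ _<_ (at-left (<-trans p<q (<-trans q<r r<a))) (at-left r<a) pr))
    (+-cancelˡ-< b _ _ (subst₂ _<_ (at-left r<a) (at-left (<-trans q<r r<a)) rq))
  ... | no r≮a with m≤n⇒∃[o]m+o≡n (≮⇒≥ r≮a)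
  ...   | r′ , refl with p <? a
  ...     | yes p<a = <⇒≱ (<-trans pr (at-right-< r′<b)) (subst (b ≤_) (sym (at-left p<a)) (m≤m+n b _))
    where r′<b = +-cancelˡ-< a r′ b (subst (a + r′ <_) length-π r<)
  ...     | no p≮a with m≤n⇒∃[o]m+o≡n (≮⇒≥ p≮a) | m≤n⇒∃[o]m+o≡n (≤-trans (≮⇒≥ p≮a) (<⇒≤ p<q))
  ...       | p′ , refl | q′ , refl = avoids B (+-cancelˡ-< a _ _ p<q) (+-cancelˡ-< a _ _ q<r)
    (+-cancelˡ-< a r′ b (subst (a + r′ <_) length-π r<))
    (subst₂ _<_ (at-right p′) (at-right r′) pr) (subst₂ _<_ (at-right r′) (at-right q′) rq)

glue-avoider : ∀ {α β} → Avoider α → Avoider β → Avoider (glue α β)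
glue-avoider A B = ⊖-avoider (appendMax-avoider A) B

-- Splitting at the maximum

unique-⊆-length : ∀ {A : Set} {xs ys : List A} → Unique xs → (∀ {x} → x ∈ xs → x ∈ ys) → length xs ≤ length ys
unique-⊆-length {xs = []}     _ _ = z≤n
unique-⊆-length {xs = x ∷ xs} {ys} (x∉ ∷ u) sub with ∈-∃++ (sub (here refl))
... | as , bs , refl = ≤-trans (s≤s (unique-⊆-length {ys = as ++ bs} u avoiding))
    (≤-reflexive (sym (length-++-sucʳ as x bs)))
  where
  avoiding : ∀ {y} → y ∈ xs → y ∈ as ++ bs
  avoiding y∈ with ∈-++⁻ as (sub (there y∈))
  ... | inj₁ y∈as           = ∈-++⁺ˡ y∈as
  ... | inj₂ (here refl)    = contradiction refl (All.lookup x∉ y∈)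
  ... | inj₂ (there y∈bs)   = ∈-++⁺ʳ as y∈bs

pigeonhole : ∀ {xs} lo hi → Unique xs → (∀ {x} → x ∈ xs → lo ≤ x × x < hi) → length xs ≤ hi ∸ lo
pigeonhole lo hi u range = subst (_ ≤_) (trans (length-map (lo +_) (upTo (hi ∸ lo))) (length-upTo (hi ∸ lo)))
  (unique-⊆-length u λ {x} x∈ → let (l , h) = range x∈ in
    subst (_∈ map (lo +_) (upTo (hi ∸ lo))) (m+[n∸m]≡n l) (∈-map⁺ (lo +_) (∈-upTo⁺ (∸-monoˡ-< h l))))

unique-++⁻ : ∀ (xs : List ℕ) {ys} → Unique (xs ++ ys) →
  Unique xs × Unique ys × (∀ {x y} → x ∈ xs → y ∈ ys → x ≢ y)
unique-++⁻ []       u = [] , u , λ ()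
unique-++⁻ (x ∷ xs) (x∉ ∷ u) with unique-++⁻ xs u
... | u₁ , u₂ , d = All.++⁻ˡ xs x∉ ∷ u₁ , u₂ ,
  λ { (here refl) y∈ → All.lookup (All.++⁻ʳ xs x∉) y∈ ; (there x∈) → d x∈ }

∈⇒at : ∀ {x} {xs : List ℕ} → x ∈ xs → ∃ λ p → p < length xs × at xs p 0 ≡ x
∈⇒at (here refl) = 0 , z<s , refl
∈⇒at (there x∈)  = let (p , l , e) = ∈⇒at x∈ in suc p , s≤s l , e

max-∈ : ∀ {n π} → Avoider π → length π ≡ suc n → n ∈ π
max-∈ {n} {π} A len with n ∈? π
... | yes n∈ = n∈
... | no n∉ = contradiction (pigeonhole 0 n (unique A) (λ {x} x∈ → z≤n ,
        ≤∧≢⇒< (s≤s⁻¹ (subst (x <_) len (All.lookup (bounded A) x∈))) (λ { refl → n∉ x∈ })))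
      (<⇒≱ (≤-reflexive (sym len)))

glue-shape : ∀ α β → glue α β ≡ map (length β +_) α ++ (length β + length α) ∷ β
glue-shape α β = trans (cong (_++ β) (map-++ (length β +_) α [ length α ])) (++-assoc (map (length β +_) α) _ β)

module Decompose {n γ β} (A : Avoider (γ ++ n ∷ β)) (len : length (γ ++ n ∷ β) ≡ suc n) where
  private
    a = length γ
    b = length β
    π = γ ++ n ∷ β
    α = map (_∸ b) γ

    n≡a+b : n ≡ a + b
    n≡a+b = sym (suc-injective (trans (sym (trans (length-++ γ) (+-suc a b))) len))

    uγ = proj₁ (unique-++⁻ γ (unique A))
    separated = proj₂ (proj₂ (unique-++⁻ γ (unique A)))

    uβ : Unique β
    uβ with unique-++⁻ γ (unique A)
    ... | _ , _ ∷ u , _ = u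

    n∉β : ∀ {y} → y ∈ β → n ≢ y
    n∉β y∈ with unique-++⁻ γ (unique A)
    ... | _ , n∉ ∷ _ , _ = All.lookup n∉ y∈

    <n : ∀ {x} → x ∈ π → x ≢ n → x < n
    <n {x} x∈ ne = ≤∧≢⇒< (s≤s⁻¹ (subst (x <_) len (All.lookup (bounded A) x∈))) ne

    γ<n : ∀ {x} → x ∈ γ → x < n
    γ<n x∈ = <n (∈-++⁺ˡ x∈) (separated x∈ (here refl))

    β<n : ∀ {y} → y ∈ β → y < n
    β<n y∈ = <n (∈-++⁺ʳ γ (there y∈)) (n∉β y∈ ∘ sym)

    at-after : ∀ p → at π (a + suc p) 0 ≡ at β p 0
    at-after p = at-++ʳ γ (n ∷ β) (suc p) 0

    at-max : at π (a + 0) 0 ≡ n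
    at-max = at-++ʳ γ (n ∷ β) 0 0

    after< : ∀ {p} → p < b → a + suc p < length π
    after< {p} l = subst (a + suc p <_) (sym (length-++ γ)) (+-monoʳ-< a (s≤s l))

    -- Otherwise x, then n, then y would form a 132.
    β<γ : ∀ {x y} → x ∈ γ → y ∈ β → y < x
    β<γ {x} {y} x∈ y∈ with ∈⇒at x∈ | ∈⇒at y∈
    ... | p , p< , refl | r , r< , refl = ≤∧≢⇒< (≮⇒≥ λ x<y →
        avoids A {p} {a + 0} {a + suc r} (subst (p <_) (sym (+-identityʳ a)) p<) (+-monoʳ-< a z<s) (after< r<)
          (subst₂ _<_ (sym (at-++ˡ γ (n ∷ β) 0 p<)) (sym (at-after r)) x<y)
          (subst₂ _<_ (sym (at-after r)) (sym at-max) (β<n y∈)))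
      (λ e → separated x∈ (there y∈) (sym e))

    -- The b distinct entries of β are all below x.
    b≤γ : ∀ {x} → x ∈ γ → b ≤ x
    b≤γ {x} x∈ = pigeonhole 0 x uβ (λ y∈ → z≤n , β<γ x∈ y∈)

    -- If b ≤ y, the a entries of γ would lie strictly between y and n, where there are fewer than n
    -- - b = a values.
    β<b : ∀ {y} → y ∈ β → y < b
    β<b {y} y∈ = ≰⇒> λ b≤y → <⇒≱
      (<-≤-trans (∸-monoʳ-< {n} ≤-refl (β<n y∈)) (≤-trans (∸-monoʳ-≤ n b≤y)
        (≤-reflexive (trans (cong (_∸ b) n≡a+b) (m+n∸n≡m a b)))))
      (pigeonhole (suc y) n uγ (λ x∈ → β<γ x∈ y∈ , γ<n x∈))

    length-α : length α ≡ a
    length-α = length-map (_∸ b) γ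

    γ≡ : map (b +_) α ≡ γ
    γ≡ = trans (sym (map-∘ γ)) (map-id-local (All.tabulate (m+[n∸m]≡n ∘ b≤γ)))

    at-α : ∀ {p} → p < length α → at π p 0 ≡ b + at α p 0
    at-α {p} l = begin
      at π p 0                      ≡⟨ at-++ˡ γ (n ∷ β) 0 (subst (p <_) length-α l) ⟩
      at γ p 0                      ≡⟨ at-default γ 0 (b + 0) (subst (p <_) length-α l) ⟩
      at γ p (b + 0)                ≡⟨ cong (λ xs → at xs p (b + 0)) γ≡ ⟨
      at (map (b +_) α) p (b + 0)   ≡⟨ at-map (b +_) α p 0 ⟩
      b + at α p 0                  ∎
      where open ≡-Reasoning

  left right : List ℕ
  left  = α
  right = β

  left-avoider : Avoider left
  left-avoider = avoider
    (All.map⁺ (All.tabulate (λ {x} x∈ → subst (x ∸ b <_)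
      (trans (cong (_∸ b) n≡a+b) (trans (m+n∸n≡m a b) (sym length-α))) (∸-monoˡ-< (γ<n x∈) (b≤γ x∈)))))
    (Unique.map⁻ {f = b +_} (subst Unique (sym γ≡) uγ))
    (λ {p} {q} {r} p<q q<r r< pr rq → avoids A p<q q<r
      (<-≤-trans (subst (r <_) length-α r<) (≤-trans (m≤m+n a _) (≤-reflexive (sym (length-++ γ)))))
      (subst₂ _<_ (sym (at-α (<-trans p<q (<-trans q<r r<)))) (sym (at-α r<)) (+-monoʳ-< b pr))
      (subst₂ _<_ (sym (at-α r<)) (sym (at-α (<-trans q<r r<))) (+-monoʳ-< b rq)))

  right-avoider : Avoider right
  right-avoider = avoider (All.tabulate β<b) uβ
    (λ {p} {q} {r} p<q q<r r< pr rq → avoids A {a + suc p} {a + suc q} {a + suc r}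
      (+-monoʳ-< a (s≤s p<q)) (+-monoʳ-< a (s≤s q<r)) (after< r<)
      (subst₂ _<_ (sym (at-after p)) (sym (at-after r)) pr)
      (subst₂ _<_ (sym (at-after r)) (sym (at-after q)) rq))

  glued : π ≡ glue left right
  glued = sym (trans (glue-shape α β) (cong₂ (λ xs m → xs ++ m ∷ β) γ≡
    (trans (cong (b +_) length-α) (trans (+-comm b a) (sym n≡a+b)))))

decompose : ∀ {n π} → Avoider π → length π ≡ suc n →
  ∃₂ λ α β → Avoider α × Avoider β × π ≡ glue α β
decompose A len with ∈-∃++ (max-∈ A len)
... | γ , β , refl = left , right , left-avoider , right-avoider , glued
  where open Decompose {γ = γ} A len

∉-split : ∀ {m : ℕ} xs xs′ {ys ys′} → All (_≢ m) xs → All (_≢ m) xs′ →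
  xs ++ m ∷ ys ≡ xs′ ++ m ∷ ys′ → xs ≡ xs′ × ys ≡ ys′
∉-split []       []         _        _        refl = refl , refl
∉-split []       (x ∷ xs′)  _        (ne ∷ _) e    = contradiction (sym (∷-injectiveˡ e)) ne
∉-split (x ∷ xs) []         (ne ∷ _) _        e    = contradiction (∷-injectiveˡ e) ne
∉-split (x ∷ xs) (x′ ∷ xs′) (_ ∷ p)  (_ ∷ q)  e with ∷-injective e
... | refl , e′ with ∉-split xs xs′ p q e′
...   | refl , refl = refl , refl

-- The length determines the maximum, which does not occur before its own position; cutting there
-- recovers both parts.
glue-injective : ∀ {α β α′ β′} → Avoider α → Avoider α′ → glue α β ≡ glue α′ β′ → α ≡ α′ × β ≡ β′
glue-injective {α} {β} {α′} {β′} A A′ e =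
  map-injective (+-cancelˡ-≡ (length β) _ _)
    (subst (λ k → map (length β +_) α ≡ map (k +_) α′) (cong length (sym β≡)) shifted≡) , β≡
  where
  max≡ : length β + length α ≡ length β′ + length α′
  max≡ = trans (+-comm (length β) (length α)) (trans (suc-injective
    (trans (sym (length-glue α β)) (trans (cong length e) (length-glue α′ β′)))) (+-comm (length α′) (length β′)))
  below-max : ∀ {α β} → Avoider α → All (_≢ length β + length α) (map (length β +_) α)
  below-max {β = β} A = All.map⁺ (All.map (λ l → <⇒≢ (+-monoʳ-< (length β) l)) (bounded A))
  both = ∉-split {length β + length α} (map (length β +_) α) (map (length β′ +_) α′) {β} {β′}
    (below-max {β = β} A) (subst (λ m → All (_≢ m) (map (length β′ +_) α′)) (sym max≡) (below-max {β = β′} A′))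
    (trans (sym (glue-shape α β)) (trans e (trans (glue-shape α′ β′)
      (cong (λ m → map (length β′ +_) α′ ++ m ∷ β′) (sym max≡)))))
  shifted≡ = proj₁ both
  β≡ = proj₂ both

-- The list of all avoiders of a given size

≡true⇒T : ∀ {b} → b ≡ true → T b
≡true⇒T refl = _

∧-true⁻ : ∀ {a b} → a ∧ b ≡ true → a ≡ true × b ≡ true
∧-true⁻ {true} e = refl , e

not-true⁻ : ∀ {b} → not b ≡ true → b ≡ false
not-true⁻ {false} _ = refl

any-false⁻ : ∀ {A : Set} (f : A → Bool) xs → any f xs ≡ false → ∀ {x} → x ∈ xs → f x ≡ false
any-false⁻ f (x ∷ xs) e (here refl) with f x
... | false = refl
any-false⁻ f (x ∷ xs) e (there x∈) with f x
... | false = any-false⁻ f xs e x∈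

any-false⁺ : ∀ {A : Set} (f : A → Bool) xs → (∀ {x} → x ∈ xs → f x ≡ false) → any f xs ≡ false
any-false⁺ f []       _ = refl
any-false⁺ f (x ∷ xs) e rewrite e (here refl) = any-false⁺ f xs (e ∘ there)

avoids132⇒Avoids132 : ∀ π → avoids132 π ≡ true → Avoids132 π
avoids132⇒Avoids132 π e {p} {q} {r} p<q q<r r< pr rq
  with trans (sym (any-false⁻ _ (upTo q) (any-false⁻ _ (upTo r) (any-false⁻ _ (upTo (length π))
    (not-true⁻ e) (∈-upTo⁺ r<)) (∈-upTo⁺ q<r)) (∈-upTo⁺ p<q))) (cong₂ _∧_ (<ᵇ-true pr) (<ᵇ-true rq))
... | ()

Avoids132⇒avoids132 : ∀ π → Avoids132 π → avoids132 π ≡ true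
Avoids132⇒avoids132 π A = cong not (any-false⁺ _ (upTo (length π)) λ {r} r∈ →
  any-false⁺ _ (upTo r) λ {q} q∈ → any-false⁺ _ (upTo q) λ {p} p∈ →
  pattern-free (A (∈-upTo⁻ p∈) (∈-upTo⁻ q∈) (∈-upTo⁻ r∈)))
  where
  pattern-free : ∀ {a b c} → (a < b → ¬ b < c) → (a <ᵇ b) ∧ (b <ᵇ c) ≡ false
  pattern-free {a} {b} {c} h with a <ᵇ b in ab | b <ᵇ c in bc
  ... | false | _     = refl
  ... | true  | false = refl
  ... | true  | true  = ⊥-elim (h (<ᵇ⇒< a b (≡true⇒T ab)) (<ᵇ⇒< b c (≡true⇒T bc)))

distinct⇒Unique : ∀ xs → distinct xs ≡ true → Unique xs
distinct⇒Unique []       _ = []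
distinct⇒Unique (x ∷ xs) e = let (h , t) = ∧-true⁻ e in
  All.tabulate (λ { {y} y∈ refl → contradiction
    (trans (sym (any-false⁻ (x ≡ᵇ_) xs (not-true⁻ h) y∈)) (≡ᵇ-refl x)) λ () })
  ∷ distinct⇒Unique xs t

Unique⇒distinct : ∀ {xs} → Unique xs → distinct xs ≡ true
Unique⇒distinct []                 = refl
Unique⇒distinct {x ∷ xs} (x∉ ∷ u) = cong₂ _∧_
  (cong not (any-false⁺ (x ≡ᵇ_) xs λ {y} y∈ → different (All.lookup x∉ y∈))) (Unique⇒distinct u)
  where
  different : ∀ {x y} → x ≢ y → (x ≡ᵇ y) ≡ false
  different {x} {y} x≢y with x ≡ᵇ y in e
  ... | false = refl
  ... | true  = contradiction (≡ᵇ⇒≡ x y (≡true⇒T e)) x≢y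

allLists-product : ∀ m n → allLists (suc m) n ≡ cartesianProductWith _∷_ (upTo n) (allLists m n)
allLists-product m n = go (upTo n)
  where
  go : ∀ xs → concatMap (λ x → map (x ∷_) (allLists m n)) xs ≡ cartesianProductWith _∷_ xs (allLists m n)
  go []       = refl
  go (x ∷ xs) = cong (map (x ∷_) (allLists m n) ++_) (go xs)

allLists-unique : ∀ m n → Unique (allLists m n)
allLists-unique zero    n = [] ∷ []
allLists-unique (suc m) n = subst Unique (sym (allLists-product m n))
  (Unique.cartesianProductWith⁺ _∷_ ∷-injective (Unique.upTo⁺ n) (allLists-unique m n))

∈-allLists⁺ : ∀ {n} xs → All (_< n) xs → xs ∈ allLists (length xs) n
∈-allLists⁺ []           []       = here refl
∈-allLists⁺ {n} (x ∷ xs) (l ∷ ls) = subst (x ∷ xs ∈_) (sym (allLists-product (length xs) n))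
  (∈-cartesianProductWith⁺ _∷_ (∈-upTo⁺ l) (∈-allLists⁺ xs ls))

∈-allLists⁻ : ∀ m {n xs} → xs ∈ allLists m n → length xs ≡ m × All (_< n) xs
∈-allLists⁻ zero    (here refl) = refl , []
∈-allLists⁻ (suc m) {n} xs∈ with ∈-cartesianProductWith⁻ _∷_ (upTo n) (allLists m n)
                                  (subst (_ ∈_) (allLists-product m n) xs∈)
... | x , xs , x∈ , xs∈′ , refl = let (len , ls) = ∈-allLists⁻ m xs∈′ in cong suc len , ∈-upTo⁻ x∈ ∷ ls

avoiders : ℕ → List (List ℕ)
avoiders n = select avoids132 (permutations n)

avoiders-unique : ∀ n → Unique (avoiders n)
avoiders-unique n = Unique.filter⁺ (λ π → avoids132 π ≟ᵇ true)
  (Unique.filter⁺ (λ π → distinct π ≟ᵇ true) (allLists-unique n n))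

∈-avoiders⁺ : ∀ {n π} → Avoider π → length π ≡ n → π ∈ avoiders n
∈-avoiders⁺ {π = π} (avoider bnd u av) refl = ∈-filter⁺ (λ π → avoids132 π ≟ᵇ true)
  (∈-filter⁺ (λ π → distinct π ≟ᵇ true) (∈-allLists⁺ π bnd) (Unique⇒distinct u))
  (Avoids132⇒avoids132 π av)

∈-avoiders⁻ : ∀ n {π} → π ∈ avoiders n → Avoider π × length π ≡ n
∈-avoiders⁻ n {π} π∈ with ∈-filter⁻ (λ π → avoids132 π ≟ᵇ true) {xs = permutations n} π∈
... | π∈′ , av with ∈-filter⁻ (λ π → distinct π ≟ᵇ true) {xs = allLists n n} π∈′
...   | π∈″ , dis with ∈-allLists⁻ n π∈″
...     | refl , bnd = avoider bnd (distinct⇒Unique π dis) (avoids132⇒Avoids132 π av) , refl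

-- The same recursion multiplies series, multiplies series of series, and
-- enumerates the pairs of given total size.
convolve : ∀ {A B C : Set} → (A → B → C) → (C → C → C) →
           (ℕ → A) → (ℕ → B) → ℕ → C
convolve _·_ _⊕_ f g zero    = f 0 · g 0
convolve _·_ _⊕_ f g (suc n) = (f 0 · g (suc n)) ⊕ convolve _·_ _⊕_ (f ∘ suc) g n

module _ {A B : Set} where
  _⊗_ : (ℕ → List A) → (ℕ → List B) → ℕ → List (A × B)
  _⊗_ = convolve cartesianProduct _++_

  ∈-⊗⁺ : ∀ (f : ℕ → List A) (g : ℕ → List B) i j {x y} → x ∈ f i → y ∈ g j → (x , y) ∈ (f ⊗ g) (i + j)
  ∈-⊗⁺ f g zero    zero    x∈ y∈ = ∈-cartesianProduct⁺ x∈ y∈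
  ∈-⊗⁺ f g zero    (suc j) x∈ y∈ = ∈-++⁺ˡ (∈-cartesianProduct⁺ x∈ y∈)
  ∈-⊗⁺ f g (suc i) j       x∈ y∈ = ∈-++⁺ʳ (cartesianProduct (f 0) (g (suc (i + j)))) (∈-⊗⁺ (f ∘ suc) g i j x∈ y∈)

  ∈-⊗⁻ : ∀ (f : ℕ → List A) (g : ℕ → List B) n {x y} → (x , y) ∈ (f ⊗ g) n →
         ∃₂ λ i j → i + j ≡ n × x ∈ f i × y ∈ g j
  ∈-⊗⁻ f g zero    xy∈ = 0 , 0 , refl , ∈-cartesianProduct⁻ (f 0) (g 0) xy∈
  ∈-⊗⁻ f g (suc n) xy∈ with ∈-++⁻ (cartesianProduct (f 0) (g (suc n))) xy∈
  ... | inj₁ p = 0 , suc n , refl , ∈-cartesianProduct⁻ (f 0) (g (suc n)) p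
  ... | inj₂ p with ∈-⊗⁻ (f ∘ suc) g n p
  ...   | i , j , e , x∈ , y∈ = suc i , j , cong suc e , x∈ , y∈

  -- The last hypothesis says that x determines its degree, so that a pair arises from a single
  -- summand of the convolution.
  ⊗-unique : ∀ (f : ℕ → List A) (g : ℕ → List B) n → (∀ i → Unique (f i)) → (∀ j → Unique (g j)) →
    (∀ {i j x} → x ∈ f i → x ∈ f j → i ≡ j) → Unique ((f ⊗ g) n)
  ⊗-unique f g zero    uf ug graded = Unique.cartesianProduct⁺ (uf 0) (ug 0)
  ⊗-unique f g (suc n) uf ug graded = Unique.++⁺ (Unique.cartesianProduct⁺ (uf 0) (ug (suc n)))
    (⊗-unique (f ∘ suc) g n (uf ∘ suc) ug (λ p q → suc-injective (graded p q)))
    (λ { {x , y} (p , q) → let (_ , _ , _ , x∈ , _) = ∈-⊗⁻ (f ∘ suc) g n q in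
         0≢1+n (graded (proj₁ (∈-cartesianProduct⁻ (f 0) (g (suc n)) p)) x∈) })

count-same-members : ∀ {xs ys : List (List ℕ)} → Unique xs → Unique ys →
  (∀ {x} → x ∈ xs → x ∈ ys) → (∀ {x} → x ∈ ys → x ∈ xs) → ∀ f → count f xs ≡ count f ys
count-same-members {xs} {ys} ux uy to from f = ≤-antisym (half ux to) (half uy from)
  where
  half : ∀ {xs ys} → Unique xs → (∀ {x} → x ∈ xs → x ∈ ys) → count f xs ≤ count f ys
  half {xs} {ys} u sub = unique-⊆-length (Unique.filter⁺ (λ x → f x ≟ᵇ true) u) λ x∈ →
    let (x∈xs , fx) = ∈-filter⁻ (λ x → f x ≟ᵇ true) {xs = xs} x∈ in ∈-filter⁺ (λ x → f x ≟ᵇ true) (sub x∈xs) fx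

glued : ℕ → List (List ℕ)
glued n = map (uncurry glue) ((avoiders ⊗ avoiders) n)

map-unique : ∀ {A B : Set} (f : A → B) {xs} → (∀ {x y} → x ∈ xs → y ∈ xs → f x ≡ f y → x ≡ y) →
  Unique xs → Unique (map f xs)
map-unique f inj []       = []
map-unique f inj (x∉ ∷ u) = All.map⁺ (All.tabulate (λ y∈ e → All.lookup x∉ y∈ (inj (here refl) (there y∈) e)))
  ∷ map-unique f (λ p q → inj (there p) (there q)) u

∈-pairs⁻ : ∀ n {α β} → (α , β) ∈ (avoiders ⊗ avoiders) n → Avoider α × Avoider β × length α + length β ≡ n
∈-pairs⁻ n p with ∈-⊗⁻ avoiders avoiders n p
... | i , j , refl , α∈ , β∈ = let (A , la) = ∈-avoiders⁻ i α∈ ; (B , lb) = ∈-avoiders⁻ j β∈ in A , B , cong₂ _+_ la lb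

glued-unique : ∀ n → Unique (glued n)
glued-unique n = map-unique (uncurry glue) injective
  (⊗-unique avoiders avoiders n avoiders-unique avoiders-unique
    (λ {i} {j} p q → trans (sym (proj₂ (∈-avoiders⁻ i p))) (proj₂ (∈-avoiders⁻ j q))))
  where
  injective : ∀ {x y} → x ∈ (avoiders ⊗ avoiders) n → y ∈ (avoiders ⊗ avoiders) n →
              uncurry glue x ≡ uncurry glue y → x ≡ y
  injective {_ , β} {_ , β′} p q e with glue-injective {β = β} {β′ = β′} (proj₁ (∈-pairs⁻ n p)) (proj₁ (∈-pairs⁻ n q)) e
  ... | refl , refl = refl

-- By existence and uniqueness of the decomposition, `glue` maps the pairs of total size n
-- bijectively onto the avoiders of size n + 1.
count-avoiders-suc : ∀ f n → count f (avoiders (suc n)) ≡ count (f ∘ uncurry glue) ((avoiders ⊗ avoiders) n)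
count-avoiders-suc f n = trans
  (count-same-members (avoiders-unique (suc n)) (glued-unique n) to from f)
  (count-map f (uncurry glue) ((avoiders ⊗ avoiders) n))
  where
  to : ∀ {π} → π ∈ avoiders (suc n) → π ∈ glued n
  to {π} π∈ with ∈-avoiders⁻ (suc n) π∈
  ... | A , len with decompose A len
  ...   | α , β , A₁ , A₂ , refl = ∈-map⁺ (uncurry glue) (subst ((α , β) ∈_)
          (cong (avoiders ⊗ avoiders) (suc-injective (trans (sym (length-glue α β)) len)))
          (∈-⊗⁺ avoiders avoiders (length α) (length β) (∈-avoiders⁺ A₁ refl) (∈-avoiders⁺ A₂ refl)))
  from : ∀ {π} → π ∈ glued n → π ∈ avoiders (suc n)
  from π∈ with ∈-map⁻ (uncurry glue) π∈
  ... | (α , β) , p , refl = let (A , B , len) = ∈-pairs⁻ n p in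
    ∈-avoiders⁺ (glue-avoider A B) (trans (length-glue α β) (cong suc len))

-- Weights

weight : List ℕ → ℕ
weight π = 2 * length π ∸ 3 * nonzeroBoxes π

-- The share of α in the weight of glue α β.
leftWeight : List ℕ → ℕ
leftWeight α = 2 * suc (length α) ∸ 3 * (nonzeroBoxes α + indicator (newBox α))

-- A lower bound for the weight of an avoider.
slack : List ℕ → ℕ
slack []        = 0
slack π@(_ ∷ _) = if topRightNonempty π then 1 else 2

-- The maximum gains 2 and a new box costs 3. A new box arises only if the corner is empty, where
-- the slack 2 covers the loss and still leaves 1.
left-bound : ∀ α → 3 * nonzeroBoxes α + slack α ≤ 2 * length α →
  3 * (nonzeroBoxes α + indicator (newBox α)) + 1 ≤ 2 * suc (length α)
left-bound [] _ = s≤s z≤n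
left-bound α@(_ ∷ _) h with topRightNonempty α
... | true  = subst₂ _≤_ (cong (λ k → 3 * k + 1) (sym (+-identityʳ (nonzeroBoxes α)))) (sym (*-suc 2 (length α)))
                (m≤n⇒m≤o+n 2 h)
... | false = subst₂ _≤_ (shape (nonzeroBoxes α)) (sym (*-suc 2 (length α))) (+-monoʳ-≤ 2 h)
  where
  shape : ∀ k → 2 + (3 * k + 2) ≡ 3 * (k + 1) + 1
  shape = solve-∀

slack≤2 : ∀ π → slack π ≤ 2
slack≤2 []        = z≤n
slack≤2 π@(_ ∷ _) with topRightNonempty π
... | true  = s≤s z≤n
... | false = ≤-refl

1≤slack : ∀ x π → 1 ≤ slack (x ∷ π)
1≤slack x π with topRightNonempty (x ∷ π)
... | true  = ≤-refl
... | false = s≤s z≤n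

slack-topRight : ∀ π → topRightNonempty π ≡ true → slack π ≤ 1
slack-topRight []        _ = z≤n
slack-topRight π@(_ ∷ _) e rewrite e = ≤-refl

-- Induction along `glue`, with k bounding the length. If β is empty and α is not, the corner is
-- filled and α alone yields the required 1. If β is nonempty, the corner is empty, and the required
-- 2 is 1 from α and at least 1 from β.
slack-bound : ∀ k π → length π ≤ k → Avoider π → 3 * nonzeroBoxes π + slack π ≤ 2 * length π
slack-bound k       []       _ _ = z≤n
slack-bound (suc k) (x ∷ π′) (s≤s l) A with decompose A refl
... | α , β , A₁ , A₂ , e = subst (λ π → 3 * nonzeroBoxes π + slack π ≤ 2 * length π) (sym e) (go α β A₁ A₂ IHα IHβ)
  where
  total : length π′ ≡ length α + length β
  total = suc-injective (trans (cong length e) (length-glue α β))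
  IHα = slack-bound k α (≤-trans (≤-trans (m≤m+n _ (length β)) (≤-reflexive (sym total))) l) A₁
  IHβ = slack-bound k β (≤-trans (≤-trans (m≤n+m _ (length α)) (≤-reflexive (sym total))) l) A₂
  core : ∀ α β → Avoider α → Avoider β →
    3 * nonzeroBoxes α + slack α ≤ 2 * length α → 3 * nonzeroBoxes β + slack β ≤ 2 * length β →
    3 * (nonzeroBoxes α + indicator (newBox α) + nonzeroBoxes β) + slack (glue α β) ≤ 2 * suc (length α + length β)
  core []         [] A₁ A₂ h₁ h₂ = ≤-refl
  core α@(_ ∷ _) [] A₁ A₂ h₁ h₂ = begin
    3 * (nα + 0) + slack (glue α [])   ≡⟨ cong (λ k → 3 * k + slack (glue α [])) (+-identityʳ nα) ⟩
    3 * nα + slack (glue α [])         ≤⟨ +-monoʳ-≤ (3 * nα) (slack-topRight (glue α []) (topRight-glue-[] α (bounded A₁))) ⟩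
    3 * nα + 1                         ≤⟨ left-bound α h₁ ⟩
    2 * suc (length α)                 ≡⟨ cong (λ k → 2 * suc k) (+-identityʳ (length α)) ⟨
    2 * suc (length α + 0)             ∎
    where
    open ≤-Reasoning
    nα = nonzeroBoxes α + indicator (newBox α)
  core α β@(y ∷ β′) A₁ A₂ h₁ h₂ = begin
    3 * (nα + nβ) + slack (glue α β)     ≤⟨ +-monoʳ-≤ (3 * (nα + nβ)) (slack≤2 (glue α β)) ⟩
    3 * (nα + nβ) + 2                    ≡⟨ regroup nα nβ ⟩
    (3 * nα + 1) + (3 * nβ + 1)          ≤⟨ +-mono-≤ (left-bound α h₁) (≤-trans (+-monoʳ-≤ (3 * nβ) (1≤slack y β′)) h₂) ⟩
    2 * suc (length α) + 2 * length β    ≡⟨ *-distribˡ-+ 2 (suc (length α)) (length β) ⟨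
    2 * suc (length α + length β)        ∎
    where
    open ≤-Reasoning
    nα = nonzeroBoxes α + indicator (newBox α)
    nβ = nonzeroBoxes β
    regroup : ∀ p q → 3 * (p + q) + 2 ≡ (3 * p + 1) + (3 * q + 1)
    regroup = solve-∀
  go : ∀ α β → Avoider α → Avoider β →
    3 * nonzeroBoxes α + slack α ≤ 2 * length α → 3 * nonzeroBoxes β + slack β ≤ 2 * length β →
    3 * nonzeroBoxes (glue α β) + slack (glue α β) ≤ 2 * length (glue α β)
  go α β A₁ A₂ h₁ h₂ = subst₂ (λ k l → 3 * k + slack (glue α β) ≤ 2 * l)
    (sym (nonzeroBoxes-glue α β (bounded A₁) (bounded A₂))) (sym (length-glue α β)) (core α β A₁ A₂ h₁ h₂)

∸-+-interchange : ∀ {m n m′ n′} → m ≤ n → m′ ≤ n′ → (n + n′) ∸ (m + m′) ≡ (n ∸ m) + (n′ ∸ m′)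
∸-+-interchange {m} {n} {m′} {n′} l l′ = begin
  (n + n′) ∸ (m + m′)   ≡⟨ ∸-+-assoc (n + n′) m m′ ⟨
  (n + n′) ∸ m ∸ m′     ≡⟨ cong (_∸ m′) (+-∸-comm n′ l) ⟩
  (n ∸ m) + n′ ∸ m′     ≡⟨ +-∸-assoc (n ∸ m) l′ ⟩
  (n ∸ m) + (n′ ∸ m′)   ∎
  where open ≡-Reasoning

module _ {π} (A : Avoider π) where
  weight-bound : 3 * nonzeroBoxes π + slack π ≤ 2 * length π
  weight-bound = slack-bound (length π) π ≤-refl A

  slack≤weight : slack π ≤ weight π
  slack≤weight = subst (_≤ weight π) (m+n∸m≡n (3 * nonzeroBoxes π) (slack π)) (∸-monoˡ-≤ (3 * nonzeroBoxes π) weight-bound)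

  boxes≤ : 3 * nonzeroBoxes π ≤ 2 * length π
  boxes≤ = ≤-trans (m≤m+n _ (slack π)) weight-bound

-- Truncated subtraction is additive here because both parts satisfy the bound.
weight-glue : ∀ {α β} → Avoider α → Avoider β → weight (glue α β) ≡ leftWeight α + weight β
weight-glue {α} {β} A B = begin
  2 * length (glue α β) ∸ 3 * nonzeroBoxes (glue α β)
    ≡⟨ cong₂ (λ l k → 2 * l ∸ 3 * k) (length-glue α β) (nonzeroBoxes-glue α β (bounded A) (bounded B)) ⟩
  2 * (suc (length α) + length β) ∸ 3 * (nα + nonzeroBoxes β)
    ≡⟨ cong₂ _∸_ (*-distribˡ-+ 2 (suc (length α)) (length β)) (*-distribˡ-+ 3 nα (nonzeroBoxes β)) ⟩
  (2 * suc (length α) + 2 * length β) ∸ (3 * nα + 3 * nonzeroBoxes β)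
    ≡⟨ ∸-+-interchange (≤-trans (m≤m+n _ 1) (left-bound α (weight-bound A))) (boxes≤ B) ⟩
  leftWeight α + weight β ∎
  where
  open ≡-Reasoning
  nα = nonzeroBoxes α + indicator (newBox α)

leftWeight-topRight : ∀ {x α} → Avoider (x ∷ α) → topRightNonempty (x ∷ α) ≡ true →
  leftWeight (x ∷ α) ≡ 2 + weight (x ∷ α)
leftWeight-topRight {x} {α} A e = begin
  2 * suc (length π) ∸ 3 * (k + indicator (not (topRightNonempty π)))
    ≡⟨ cong₂ (λ l b → l ∸ 3 * (k + indicator (not b))) (*-suc 2 (length π)) e ⟩
  2 + 2 * length π ∸ 3 * (k + 0)   ≡⟨ cong (λ k → 2 + 2 * length π ∸ 3 * k) (+-identityʳ k) ⟩
  2 + 2 * length π ∸ 3 * k         ≡⟨ +-∸-assoc 2 (boxes≤ A) ⟩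
  2 + weight π                     ∎
  where
  open ≡-Reasoning
  π = x ∷ α
  k = nonzeroBoxes π

-- The left weight is the weight minus 1; the witness v expresses this without subtraction and
-- records that the weight is at least 2.
leftWeight-¬topRight : ∀ {x α} → Avoider (x ∷ α) → topRightNonempty (x ∷ α) ≡ false →
  ∃ λ v → leftWeight (x ∷ α) ≡ suc v × weight (x ∷ α) ≡ 2 + v
leftWeight-¬topRight {x} {α} A e = v , left , right
  where
  open ≡-Reasoning
  π = x ∷ α
  k = nonzeroBoxes π
  v = 2 * length π ∸ (3 * k + 2)
  slack≡2 : slack π ≡ 2
  slack≡2 = cong (λ b → if b then 1 else 2) e
  bound : 3 * k + 2 ≤ 2 * length π
  bound = subst (λ s → 3 * k + s ≤ 2 * length π) slack≡2 (weight-bound A)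
  total : 2 * length π ≡ 3 * k + (2 + v)
  total = trans (sym (m+[n∸m]≡n bound)) (+-assoc (3 * k) 2 v)
  right : weight π ≡ 2 + v
  right = trans (cong (_∸ 3 * k) total) (m+n∸m≡n (3 * k) (2 + v))
  shape : ∀ k v → 2 + (3 * k + (2 + v)) ≡ 3 * (k + 1) + (1 + v)
  shape = solve-∀
  left : leftWeight π ≡ suc v
  left = begin
    2 * suc (length π) ∸ 3 * (k + indicator (not (topRightNonempty π)))
      ≡⟨ cong₂ (λ l b → l ∸ 3 * (k + indicator (not b)))
           (trans (*-suc 2 (length π)) (trans (cong (λ z → 2 + z) total) (shape k v))) e ⟩
    3 * (k + 1) + (1 + v) ∸ 3 * (k + 1)       ≡⟨ m+n∸m≡n (3 * (k + 1)) (1 + v) ⟩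
    1 + v                                     ∎

-- Formal power series over ℤ

open import Data.Integer as ℤ using (ℤ; +_; 0ℤ; 1ℤ)
import Data.Integer.Properties as ℤ
import Data.Integer.Tactic.RingSolver as ℤ-Solver
open import Algebra.Properties.AbelianGroup ℤ.+-0-abelianGroup using (∙-cancelʳ)

Series : Set
Series = ℕ → ℤ

infixl 6 _+ₛ_
infixl 7 _*ₛ_
infix 8 -ₛ_

_+ₛ_ _*ₛ_ : Series → Series → Series
(f +ₛ g) n = f n ℤ.+ g n
_*ₛ_ = convolve ℤ._*_ ℤ._+_

-ₛ_ : Series → Series
(-ₛ f) n = ℤ.- f n

constant : ℤ → Series
constant c zero    = c
constant c (suc n) = 0ℤ

*ₛ-cong : ∀ {f f′ g g′} → f ≗ f′ → g ≗ g′ → f *ₛ g ≗ f′ *ₛ g′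
*ₛ-cong p q zero    = cong₂ ℤ._*_ (p 0) (q 0)
*ₛ-cong p q (suc n) = cong₂ ℤ._+_ (cong₂ ℤ._*_ (p 0) (q (suc n))) (*ₛ-cong (p ∘ suc) q n)

*ₛ-distribʳ : ∀ h f g → (f +ₛ g) *ₛ h ≗ f *ₛ h +ₛ g *ₛ h
*ₛ-distribʳ h f g zero    = ℤ.*-distribʳ-+ (h 0) (f 0) (g 0)
*ₛ-distribʳ h f g (suc n) = begin
  (f 0 ℤ.+ g 0) ℤ.* h (suc n) ℤ.+ ((f +ₛ g) ∘ suc *ₛ h) n
    ≡⟨ cong (ℤ._+_ ((f 0 ℤ.+ g 0) ℤ.* h (suc n))) (*ₛ-distribʳ h (f ∘ suc) (g ∘ suc) n) ⟩
  (f 0 ℤ.+ g 0) ℤ.* h (suc n) ℤ.+ ((f ∘ suc *ₛ h) n ℤ.+ (g ∘ suc *ₛ h) n)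
    ≡⟨ rearrange (f 0) (g 0) (h (suc n)) _ _ ⟩
  _ ∎
  where
  open ≡-Reasoning
  rearrange : ∀ a b c d e → (a ℤ.+ b) ℤ.* c ℤ.+ (d ℤ.+ e) ≡ (a ℤ.* c ℤ.+ d) ℤ.+ (b ℤ.* c ℤ.+ e)
  rearrange = ℤ-Solver.solve-∀

*ₛ-scale : ∀ c f g → (λ n → c ℤ.* f n) *ₛ g ≗ (λ n → c ℤ.* (f *ₛ g) n)
*ₛ-scale c f g zero    = ℤ.*-assoc c (f 0) (g 0)
*ₛ-scale c f g (suc n) = begin
  c ℤ.* f 0 ℤ.* g (suc n) ℤ.+ ((λ n → c ℤ.* f (suc n)) *ₛ g) n
    ≡⟨ cong₂ ℤ._+_ (ℤ.*-assoc c (f 0) _) (*ₛ-scale c (f ∘ suc) g n) ⟩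
  c ℤ.* (f 0 ℤ.* g (suc n)) ℤ.+ c ℤ.* (f ∘ suc *ₛ g) n
    ≡⟨ ℤ.*-distribˡ-+ c _ _ ⟨
  _ ∎
  where open ≡-Reasoning

*ₛ-assoc : ∀ f g h → (f *ₛ g) *ₛ h ≗ f *ₛ (g *ₛ h)
*ₛ-assoc f g h zero    = ℤ.*-assoc (f 0) (g 0) (h 0)
*ₛ-assoc f g h (suc n) = begin
  f 0 ℤ.* g 0 ℤ.* h (suc n) ℤ.+ (((λ n → f 0 ℤ.* g (suc n)) +ₛ f ∘ suc *ₛ g) *ₛ h) n
    ≡⟨ cong (ℤ._+_ (f 0 ℤ.* g 0 ℤ.* h (suc n))) (*ₛ-distribʳ h (λ n → f 0 ℤ.* g (suc n)) (f ∘ suc *ₛ g) n) ⟩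
  f 0 ℤ.* g 0 ℤ.* h (suc n) ℤ.+ (((λ n → f 0 ℤ.* g (suc n)) *ₛ h) n ℤ.+ (f ∘ suc *ₛ g *ₛ h) n)
    ≡⟨ cong (ℤ._+_ (f 0 ℤ.* g 0 ℤ.* h (suc n))) (cong₂ ℤ._+_ (*ₛ-scale (f 0) (g ∘ suc) h n) (*ₛ-assoc (f ∘ suc) g h n)) ⟩
  f 0 ℤ.* g 0 ℤ.* h (suc n) ℤ.+ (f 0 ℤ.* (g ∘ suc *ₛ h) n ℤ.+ (f ∘ suc *ₛ (g *ₛ h)) n)
    ≡⟨ rearrange (f 0) (g 0) (h (suc n)) _ _ ⟩
  _ ∎
  where
  open ≡-Reasoning
  rearrange : ∀ a b c d e → a ℤ.* b ℤ.* c ℤ.+ (a ℤ.* d ℤ.+ e) ≡ a ℤ.* (b ℤ.* c ℤ.+ d) ℤ.+ e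
  rearrange = ℤ-Solver.solve-∀

-- Unfolds the convolution from the other end, which is what commutativity needs.
*ₛ-suc : ∀ f g n → (f *ₛ g) (suc n) ≡ (f *ₛ (g ∘ suc)) n ℤ.+ f (suc n) ℤ.* g 0
*ₛ-suc f g zero    = refl
*ₛ-suc f g (suc n) = begin
  f 0 ℤ.* g (2 + n) ℤ.+ (f ∘ suc *ₛ g) (suc n)
    ≡⟨ cong (ℤ._+_ (f 0 ℤ.* g (2 + n))) (*ₛ-suc (f ∘ suc) g n) ⟩
  f 0 ℤ.* g (2 + n) ℤ.+ ((f ∘ suc *ₛ (g ∘ suc)) n ℤ.+ f (2 + n) ℤ.* g 0)
    ≡⟨ ℤ.+-assoc (f 0 ℤ.* g (2 + n)) _ _ ⟨
  _ ∎
  where open ≡-Reasoning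

*ₛ-comm : ∀ f g → f *ₛ g ≗ g *ₛ f
*ₛ-comm f g zero    = ℤ.*-comm (f 0) (g 0)
*ₛ-comm f g (suc n) = begin
  f 0 ℤ.* g (suc n) ℤ.+ (f ∘ suc *ₛ g) n
    ≡⟨ cong₂ ℤ._+_ (ℤ.*-comm (f 0) _) (*ₛ-comm (f ∘ suc) g n) ⟩
  g (suc n) ℤ.* f 0 ℤ.+ (g *ₛ (f ∘ suc)) n
    ≡⟨ ℤ.+-comm (g (suc n) ℤ.* f 0) _ ⟩
  (g *ₛ (f ∘ suc)) n ℤ.+ g (suc n) ℤ.* f 0
    ≡⟨ *ₛ-suc g f n ⟨
  (g *ₛ f) (suc n) ∎
  where open ≡-Reasoning

*ₛ-zeroˡ : ∀ f → (λ _ → 0ℤ) *ₛ f ≗ (λ _ → 0ℤ)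
*ₛ-zeroˡ f zero    = refl
*ₛ-zeroˡ f (suc n) = trans (ℤ.+-identityˡ _) (*ₛ-zeroˡ f n)

constant-*ₛ : ∀ c f → constant c *ₛ f ≗ (λ n → c ℤ.* f n)
constant-*ₛ c f zero    = refl
constant-*ₛ c f (suc n) = trans (cong (ℤ._+_ (c ℤ.* f (suc n))) (*ₛ-zeroˡ f n)) (ℤ.+-identityʳ _)

*ₛ-identityˡ : ∀ f → constant 1ℤ *ₛ f ≗ f
*ₛ-identityˡ f n = trans (constant-*ₛ 1ℤ f n) (ℤ.*-identityˡ (f n))

seriesRing : CommutativeRing 0ℓ 0ℓ
seriesRing = record
  { Carrier = Series
  ; _≈_ = _≗_
  ; _+_ = _+ₛ_
  ; _*_ = _*ₛ_
  ; -_ = -ₛ_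
  ; 0# = λ _ → 0ℤ
  ; 1# = constant 1ℤ
  ; isCommutativeRing = record
    { isRing = record
      { +-isAbelianGroup = record
        { isGroup = record
          { isMonoid = record
            { isSemigroup = record
              { isMagma = record
                { isEquivalence = record
                  { refl = λ _ → refl
                  ; sym = λ p n → sym (p n)
                  ; trans = λ p q n → trans (p n) (q n) }
                ; ∙-cong = λ p q n → cong₂ ℤ._+_ (p n) (q n) }
              ; assoc = λ f g h n → ℤ.+-assoc (f n) (g n) (h n) }
            ; identity = (λ f n → ℤ.+-identityˡ (f n)) , (λ f n → ℤ.+-identityʳ (f n)) }
          ; inverse = (λ f n → ℤ.+-inverseˡ (f n)) , (λ f n → ℤ.+-inverseʳ (f n))
          ; ⁻¹-cong = λ p n → cong ℤ.-_ (p n) }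
        ; comm = λ f g n → ℤ.+-comm (f n) (g n) }
      ; *-cong = *ₛ-cong
      ; *-assoc = *ₛ-assoc
      ; *-identity = *ₛ-identityˡ , λ f n → trans (*ₛ-comm f _ n) (*ₛ-identityˡ f n)
      ; distrib = (λ f g h n → trans (*ₛ-comm f _ n) (trans (*ₛ-distribʳ f g h n)
                    (cong₂ ℤ._+_ (*ₛ-comm g f n) (*ₛ-comm h f n))))
                , *ₛ-distribʳ }
    ; *-comm = *ₛ-comm } }

module R = CommutativeRing seriesRing

import Relation.Binary.Reasoning.Setoid R.setoid as ≗-Reasoning

-- Integers as coefficients give the ring solver decidable constants, so that numerical coefficients
-- of series cancel.
constant-homomorphism : CommutativeRing.rawRing ℤ.+-*-commutativeRing
                        -Raw-AlmostCommutative⟶ fromCommutativeRing seriesRing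
constant-homomorphism = record
  { ⟦_⟧    = constant
  ; +-homo = λ { _ _ zero → refl ; _ _ (suc _) → refl }
  ; *-homo = λ { _ _ zero → refl ; a b (suc n) → sym (trans (constant-*ₛ a (constant b) (suc n)) (ℤ.*-zeroʳ a)) }
  ; -‿homo = λ { _ zero → refl ; _ (suc _) → refl }
  ; 0-homo = λ { zero → refl ; (suc _) → refl }
  ; 1-homo = λ _ → refl
  }

constant-≟ : ∀ a b → Maybe (constant a ≗ constant b)
constant-≟ a b = Maybe.map (λ p n → cong (λ c → constant c n) p) (dec⇒maybe (a ℤ.≟ b))

module Solver = RingSolver (CommutativeRing.rawRing ℤ.+-*-commutativeRing)
  (fromCommutativeRing seriesRing) constant-homomorphism constant-≟

open Solver using (solve; _:=_; _:+_; _:*_; _:-_; con)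

infixl 6 _-ₛ_
_-ₛ_ : Series → Series → Series
f -ₛ g = f +ₛ -ₛ g

private
  -- `𝟘` is the solver's `con 0ℤ`; it agrees with the zero `λ _ → 0ℤ` of `seriesRing` only
  -- pointwise, hence the case splits below.
  𝟘 𝟙 : Series
  𝟘 = constant 0ℤ
  𝟙 = constant 1ℤ

-- Consequences of polynomial equations are proved by ideal membership: the solver writes a
-- difference as a combination of the differences of the hypotheses, and the next lemmas make every
-- summand vanish.
minus-zero : ∀ f g → f ≗ g → f -ₛ g ≗ 𝟘
minus-zero f g p = R.trans (R.+-congʳ { -ₛ g} p) (R.trans (R.-‿inverseʳ g) (λ { zero → refl ; (suc _) → refl }))

from-difference : ∀ {f g} → f -ₛ g ≗ 𝟘 → f ≗ g
from-difference {f} {g} p = R.trans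
  (solve 2 (λ f g → f := f :- g :+ g) (λ _ → refl) f g)
  (R.trans (R.+-congʳ {g} p) (solve 1 (λ g → con 0ℤ :+ g := g) (λ _ → refl) g))

zero-+ : ∀ {f g} → f ≗ 𝟘 → g ≗ 𝟘 → f +ₛ g ≗ 𝟘
zero-+ p q = R.trans (R.+-cong p q) (λ { zero → refl ; (suc _) → refl })

zero-- : ∀ {f g} → f ≗ 𝟘 → g ≗ 𝟘 → f -ₛ g ≗ 𝟘
zero-- p q = zero-+ p (R.trans (R.-‿cong q) (λ { zero → refl ; (suc _) → refl }))

zero-* : ∀ c {f} → f ≗ 𝟘 → c *ₛ f ≗ 𝟘
zero-* c p = R.trans (R.*-congˡ {c} p) (solve 1 (λ c → c :* con 0ℤ := con 0ℤ) (λ _ → refl) c)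

-- The variable, its cube and the Euler derivation

X : Series
X 1 = 1ℤ
X _ = 0ℤ

X*ₛ-suc : ∀ f n → (X *ₛ f) (suc n) ≡ f n
X*ₛ-suc f n = begin
  0ℤ ℤ.* f (suc n) ℤ.+ (X ∘ suc *ₛ f) n  ≡⟨ ℤ.+-identityˡ _ ⟩
  (X ∘ suc *ₛ f) n                       ≡⟨ *ₛ-cong {g = f} (λ { zero → refl ; (suc _) → refl }) (λ _ → refl) n ⟩
  (constant 1ℤ *ₛ f) n                   ≡⟨ *ₛ-identityˡ f n ⟩
  f n                                    ∎
  where open ≡-Reasoning

shift-by-X : ∀ {f g} → f 0 ≡ 0ℤ → (∀ n → f (suc n) ≡ g n) → f ≗ X *ₛ g
shift-by-X p q zero    = p
shift-by-X p q (suc n) = trans (q n) (sym (X*ₛ-suc _ n))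

X³ : Series
X³ = X *ₛ X *ₛ X

X³*ₛ-+3 : ∀ f n → (X³ *ₛ f) (3 + n) ≡ f n
X³*ₛ-+3 f n = begin
  (X³ *ₛ f) (3 + n)                ≡⟨ trans (*ₛ-assoc (X *ₛ X) X f (3 + n)) (*ₛ-assoc X X (X *ₛ f) (3 + n)) ⟩
  (X *ₛ (X *ₛ (X *ₛ f))) (3 + n)   ≡⟨ X*ₛ-suc (X *ₛ (X *ₛ f)) (2 + n) ⟩
  (X *ₛ (X *ₛ f)) (2 + n)          ≡⟨ X*ₛ-suc (X *ₛ f) (1 + n) ⟩
  (X *ₛ f) (1 + n)                 ≡⟨ X*ₛ-suc f n ⟩
  f n                                ∎
  where open ≡-Reasoning

-- The derivation x d/dx.
θ : Series → Series
θ f n = + n ℤ.* f n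

θ-cong : ∀ {f g} → f ≗ g → θ f ≗ θ g
θ-cong p n = cong (+ n ℤ.*_) (p n)

θ-+ₛ : ∀ f g → θ (f +ₛ g) ≗ θ f +ₛ θ g
θ-+ₛ f g n = ℤ.*-distribˡ-+ (+ n) (f n) (g n)

θ-*ₛ : ∀ f g → θ (f *ₛ g) ≗ θ f *ₛ g +ₛ f *ₛ θ g
θ-*ₛ f g zero    = sym (trans (ℤ.+-identityˡ _) (ℤ.*-zeroʳ (f 0)))
θ-*ₛ f g (suc n) = begin
  k ℤ.* (f 0 ℤ.* g (suc n) ℤ.+ (f′ *ₛ g) n)
    ≡⟨ split (+ n) (f 0) (g (suc n)) _ ⟩
  f 0 ℤ.* (k ℤ.* g (suc n)) ℤ.+ ((f′ *ₛ g) n ℤ.+ θ (f′ *ₛ g) n)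
    ≡⟨ cong (λ z → f 0 ℤ.* (k ℤ.* g (suc n)) ℤ.+ ((f′ *ₛ g) n ℤ.+ z)) (θ-*ₛ f′ g n) ⟩
  f 0 ℤ.* (k ℤ.* g (suc n)) ℤ.+ ((f′ *ₛ g) n ℤ.+ ((θ f′ *ₛ g) n ℤ.+ (f′ *ₛ θ g) n))
    ≡⟨ regroup (f 0 ℤ.* (k ℤ.* g (suc n))) ((f′ *ₛ g) n) ((θ f′ *ₛ g) n) ((f′ *ₛ θ g) n) ⟩
  ((f′ *ₛ g) n ℤ.+ (θ f′ *ₛ g) n) ℤ.+ (f 0 ℤ.* (k ℤ.* g (suc n)) ℤ.+ (f′ *ₛ θ g) n)
    ≡⟨ cong (ℤ._+ (f *ₛ θ g) (suc n)) (*ₛ-distribʳ g f′ (θ f′) n) ⟨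
  ((f′ +ₛ θ f′) *ₛ g) n ℤ.+ (f *ₛ θ g) (suc n)
    ≡⟨ cong (ℤ._+ (f *ₛ θ g) (suc n)) (*ₛ-cong {g = g} (λ m → next (+ m) (f′ m)) (λ _ → refl) n) ⟩
  (θ f ∘ suc *ₛ g) n ℤ.+ (f *ₛ θ g) (suc n)
    ≡⟨ cong (ℤ._+ (f *ₛ θ g) (suc n)) (ℤ.+-identityˡ ((θ f ∘ suc *ₛ g) n)) ⟨
  (θ f *ₛ g +ₛ f *ₛ θ g) (suc n) ∎
  where
  open ≡-Reasoning
  f′ = f ∘ suc
  k = + suc n
  split : ∀ n a b c → (1ℤ ℤ.+ n) ℤ.* (a ℤ.* b ℤ.+ c) ≡ a ℤ.* ((1ℤ ℤ.+ n) ℤ.* b) ℤ.+ (c ℤ.+ n ℤ.* c)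
  split = ℤ-Solver.solve-∀
  regroup : ∀ a b c d → a ℤ.+ (b ℤ.+ (c ℤ.+ d)) ≡ (b ℤ.+ c) ℤ.+ (a ℤ.+ d)
  regroup = ℤ-Solver.solve-∀
  next : ∀ m a → a ℤ.+ m ℤ.* a ≡ (1ℤ ℤ.+ m) ℤ.* a
  next = ℤ-Solver.solve-∀

θ-constant : ∀ c → θ (constant c) ≗ constant 0ℤ
θ-constant c zero    = refl
θ-constant c (suc n) = ℤ.*-zeroʳ (+ suc n)

θ-X : θ X ≗ X
θ-X 0 = refl
θ-X 1 = refl
θ-X (suc (suc n)) = ℤ.*-zeroʳ (+ suc (suc n))

θ-X³ : θ X³ ≗ constant (+ 3) *ₛ X³
θ-X³ = begin
  θ (X *ₛ X *ₛ X)
    ≈⟨ θ-*ₛ (X *ₛ X) X ⟩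
  θ (X *ₛ X) *ₛ X +ₛ X *ₛ X *ₛ θ X
    ≈⟨ R.+-cong (R.*-congʳ {X} (θ-*ₛ X X)) (R.refl {X *ₛ X *ₛ θ X}) ⟩
  (θ X *ₛ X +ₛ X *ₛ θ X) *ₛ X +ₛ X *ₛ X *ₛ θ X
    ≈⟨ R.+-cong (R.*-congʳ {X} (R.+-cong (R.*-congʳ {X} θ-X) (R.*-congˡ {X} θ-X)))
                 (R.*-congˡ {X *ₛ X} θ-X) ⟩
  (X *ₛ X +ₛ X *ₛ X) *ₛ X +ₛ X *ₛ X *ₛ X
    ≈⟨ solve 1 (λ x → (x :* x :+ x :* x) :* x :+ x :* x :* x := con (+ 3) :* (x :* x :* x)) (λ _ → refl) X ⟩
  constant (+ 3) *ₛ X³ ∎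
  where open ≗-Reasoning

-- The derivation kills s³h, so only its constant term survives; since the
-- hypothesis on s² yields just 2 s θs, it is 2 θ(s³h) that is computed.
cube-times-inverse-cube : ∀ s h → s 0 ≡ 1ℤ → h 0 ≡ 1ℤ →
  s *ₛ s ≗ constant 1ℤ -ₛ constant (+ 4) *ₛ X³ →
  θ h ≗ constant (+ 4) *ₛ X³ *ₛ θ h +ₛ constant (+ 18) *ₛ X³ *ₛ h →
  s *ₛ s *ₛ s *ₛ h ≗ constant 1ℤ
cube-times-inverse-cube s h s₀ h₀ ss hh = λ where
    zero    → trans (cong₂ (λ a b → a ℤ.* a ℤ.* a ℤ.* b) s₀ h₀) refl
    -- In positive degree the factors 2 and n + 1 can be cancelled from 2 θ g = 0.
    (suc n) → ℤ.*-cancelˡ-≡ (+ 2) _ 0ℤ (ℤ.*-cancelˡ-≡ (+ suc n) _ 0ℤ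
      (trans (commute (+ suc n) _) (trans (twice-θ (suc n)) (sym (ℤ.*-zeroʳ (+ suc n))))))
  where
  open ≗-Reasoning
  g = s *ₛ s *ₛ s *ₛ h
  commute : ∀ m z → m ℤ.* (+ 2 ℤ.* z) ≡ + 2 ℤ.* (m ℤ.* z)
  commute = ℤ-Solver.solve-∀
  θss : θ s *ₛ s +ₛ s *ₛ θ s ≗ constant 0ℤ -ₛ constant (+ 12) *ₛ X³
  θss = begin
    θ s *ₛ s +ₛ s *ₛ θ s
      ≈⟨ θ-*ₛ s s ⟨
    θ (s *ₛ s)
      ≈⟨ θ-cong (R.trans ss (solve 1 (λ x → con 1ℤ :- con (+ 4) :* x := con 1ℤ :+ con (ℤ.- (+ 4)) :* x) (λ _ → refl) X³)) ⟩
    θ (constant 1ℤ +ₛ constant (ℤ.- (+ 4)) *ₛ X³)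
      ≈⟨ θ-+ₛ (constant 1ℤ) (constant (ℤ.- (+ 4)) *ₛ X³) ⟩
    θ (constant 1ℤ) +ₛ θ (constant (ℤ.- (+ 4)) *ₛ X³)
      ≈⟨ R.+-cong (θ-constant 1ℤ) (θ-*ₛ (constant (ℤ.- (+ 4))) X³) ⟩
    constant 0ℤ +ₛ (θ (constant (ℤ.- (+ 4))) *ₛ X³ +ₛ constant (ℤ.- (+ 4)) *ₛ θ X³)
      ≈⟨ R.+-congˡ {constant 0ℤ} (R.+-cong (R.*-congʳ {X³} (θ-constant (ℤ.- (+ 4)))) (R.*-congˡ {constant (ℤ.- (+ 4))} θ-X³)) ⟩
    constant 0ℤ +ₛ (constant 0ℤ *ₛ X³ +ₛ constant (ℤ.- (+ 4)) *ₛ (constant (+ 3) *ₛ X³))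
      ≈⟨ solve 1 (λ x → con 0ℤ :+ (con 0ℤ :* x :+ con (ℤ.- (+ 4)) :* (con (+ 3) :* x)) := con 0ℤ :- con (+ 12) :* x) (λ _ → refl) X³ ⟩
    constant 0ℤ -ₛ constant (+ 12) *ₛ X³ ∎
  twice-θ : ∀ n → + 2 ℤ.* θ g n ≡ 0ℤ
  twice-θ n = trans (sym (constant-*ₛ (+ 2) (θ g) n)) (trans (chain n) (constant-zero n))
    where
    constant-zero : ∀ n → constant 0ℤ n ≡ 0ℤ
    constant-zero zero    = refl
    constant-zero (suc _) = refl
    ds = θ s
    dh = θ h
    chain : constant (+ 2) *ₛ θ g ≗ constant 0ℤ
    chain = begin
      constant (+ 2) *ₛ θ g
        ≈⟨ R.*-congˡ {constant (+ 2)} (θ-*ₛ (s *ₛ s *ₛ s) h) ⟩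
      constant (+ 2) *ₛ (θ (s *ₛ s *ₛ s) *ₛ h +ₛ s *ₛ s *ₛ s *ₛ dh)
        ≈⟨ R.*-congˡ {constant (+ 2)} (R.+-congʳ {s *ₛ s *ₛ s *ₛ dh} (R.*-congʳ {h}
             (R.trans (θ-*ₛ (s *ₛ s) s) (R.+-congʳ {s *ₛ s *ₛ ds} (R.*-congʳ {s} (θ-*ₛ s s)))))) ⟩
      constant (+ 2) *ₛ (((ds *ₛ s +ₛ s *ₛ ds) *ₛ s +ₛ s *ₛ s *ₛ ds) *ₛ h +ₛ s *ₛ s *ₛ s *ₛ dh)
        -- 2 θ(s³h) = 3sh · 2sθs + 2s³θh. Replacing 2sθs by -12x³ and s² by 1 - 4x³ leaves 2s((1 -
        -- 4x³) θh - 18x³h), which the equation of h annihilates.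
        ≈⟨ solve 5 (λ s ds h dh x →
             con (+ 2) :* (((ds :* s :+ s :* ds) :* s :+ s :* s :* ds) :* h :+ s :* s :* s :* dh)
             := con (+ 3) :* s :* h :* (ds :* s :+ s :* ds :- (con 0ℤ :- con (+ 12) :* x))
             :+ con (+ 2) :* s :* dh :* (s :* s :- (con 1ℤ :- con (+ 4) :* x))
             :+ con (+ 2) :* s :* (dh :- (con (+ 4) :* x :* dh :+ con (+ 18) :* x :* h)))
             (λ _ → refl) s ds h dh X³ ⟩
      constant (+ 3) *ₛ s *ₛ h *ₛ (ds *ₛ s +ₛ s *ₛ ds -ₛ (constant 0ℤ -ₛ constant (+ 12) *ₛ X³))
        +ₛ constant (+ 2) *ₛ s *ₛ dh *ₛ (s *ₛ s -ₛ (constant 1ℤ -ₛ constant (+ 4) *ₛ X³))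
        +ₛ constant (+ 2) *ₛ s *ₛ (dh -ₛ (constant (+ 4) *ₛ X³ *ₛ dh +ₛ constant (+ 18) *ₛ X³ *ₛ h))
        ≈⟨ zero-+ (zero-+ (zero-* (constant (+ 3) *ₛ s *ₛ h) (minus-zero _ _ θss))
                          (zero-* (constant (+ 2) *ₛ s *ₛ dh) (minus-zero _ _ ss)))
                  (zero-* (constant (+ 2) *ₛ s) (minus-zero _ _ hh)) ⟩
      constant 0ℤ ∎

-- The substitution of x³ for the variable.
spread : (ℕ → ℤ) → Series
spread g 0 = g 0
spread g 1 = 0ℤ
spread g 2 = 0ℤ
spread g (suc (suc (suc n))) = spread (g ∘ suc) n

spread-3* : ∀ g i → spread g (i * 3) ≡ g i
spread-3* g zero    = refl
spread-3* g (suc i) = spread-3* (g ∘ suc) i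

-- The offset j makes the claim stable under dropping the first coefficient of g.
spread-recurrence : ∀ j g →
  (∀ i → (1ℤ ℤ.+ (j ℤ.+ + i)) ℤ.* g (suc i) ≡ (+ 4 ℤ.* (j ℤ.+ + i) ℤ.+ + 6) ℤ.* g i) →
  ∀ n → (+ 3 ℤ.+ (+ 3 ℤ.* j ℤ.+ + n)) ℤ.* spread g (3 + n)
        ≡ + 4 ℤ.* ((+ 3 ℤ.* j ℤ.+ + n) ℤ.* spread g n) ℤ.+ + 18 ℤ.* spread g n
spread-recurrence j g rec 0 = begin
  (+ 3 ℤ.+ (+ 3 ℤ.* j ℤ.+ + 0)) ℤ.* g 1                      ≡⟨ left j (g 1) ⟩
  + 3 ℤ.* ((1ℤ ℤ.+ (j ℤ.+ + 0)) ℤ.* g 1)                      ≡⟨ cong (+ 3 ℤ.*_) (rec 0) ⟩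
  + 3 ℤ.* ((+ 4 ℤ.* (j ℤ.+ + 0) ℤ.+ + 6) ℤ.* g 0)              ≡⟨ right j (g 0) ⟩
  + 4 ℤ.* ((+ 3 ℤ.* j ℤ.+ + 0) ℤ.* g 0) ℤ.+ + 18 ℤ.* g 0       ∎
  where
  open ≡-Reasoning
  left : ∀ j a → (+ 3 ℤ.+ (+ 3 ℤ.* j ℤ.+ + 0)) ℤ.* a ≡ + 3 ℤ.* ((1ℤ ℤ.+ (j ℤ.+ + 0)) ℤ.* a)
  left = ℤ-Solver.solve-∀
  right : ∀ j a → + 3 ℤ.* ((+ 4 ℤ.* (j ℤ.+ + 0) ℤ.+ + 6) ℤ.* a) ≡ + 4 ℤ.* ((+ 3 ℤ.* j ℤ.+ + 0) ℤ.* a) ℤ.+ + 18 ℤ.* a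
  right = ℤ-Solver.solve-∀
spread-recurrence j g rec 1 = vanish (+ 3 ℤ.* j ℤ.+ + 1)
  where
  vanish : ∀ a → (+ 3 ℤ.+ a) ℤ.* 0ℤ ≡ + 4 ℤ.* (a ℤ.* 0ℤ) ℤ.+ + 18 ℤ.* 0ℤ
  vanish = ℤ-Solver.solve-∀
spread-recurrence j g rec 2 = vanish (+ 3 ℤ.* j ℤ.+ + 2)
  where
  vanish : ∀ a → (+ 3 ℤ.+ a) ℤ.* 0ℤ ≡ + 4 ℤ.* (a ℤ.* 0ℤ) ℤ.+ + 18 ℤ.* 0ℤ
  vanish = ℤ-Solver.solve-∀
spread-recurrence j g rec (suc (suc (suc n))) =
  subst (λ z → (+ 3 ℤ.+ z) ℤ.* spread g (6 + n) ≡ + 4 ℤ.* (z ℤ.* spread g (3 + n)) ℤ.+ + 18 ℤ.* spread g (3 + n))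
    (reindex j (+ n))
    (spread-recurrence (1ℤ ℤ.+ j) (g ∘ suc)
      (λ i → subst (λ z → (1ℤ ℤ.+ z) ℤ.* g (2 + i) ≡ (+ 4 ℤ.* z ℤ.+ + 6) ℤ.* g (suc i)) (step j (+ i)) (rec (suc i))) n)
  where
  step : ∀ j i → j ℤ.+ (1ℤ ℤ.+ i) ≡ 1ℤ ℤ.+ j ℤ.+ i
  step = ℤ-Solver.solve-∀
  reindex : ∀ j n → + 3 ℤ.* (1ℤ ℤ.+ j) ℤ.+ n ≡ + 3 ℤ.* j ℤ.+ (+ 3 ℤ.+ n)
  reindex = ℤ-Solver.solve-∀

inverseCube : Series
inverseCube = spread (+_ ∘ cubeCoeff)

-- Three times `cubeCoeff-suc`, as θ multiplies the coefficient with index m by 3m: 3(4m + 6) = 4 ·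
-- 3m + 18.
θ-inverseCube : θ inverseCube ≗
  constant (+ 4) *ₛ X³ *ₛ θ inverseCube +ₛ constant (+ 18) *ₛ X³ *ₛ inverseCube
θ-inverseCube 0 = refl
θ-inverseCube 1 = refl
θ-inverseCube 2 = refl
θ-inverseCube (suc (suc (suc n))) = begin
  (+ (3 + n)) ℤ.* h (3 + n)
    ≡⟨ subst (λ z → (+ 3 ℤ.+ z) ℤ.* h (3 + n) ≡ + 4 ℤ.* (z ℤ.* h n) ℤ.+ + 18 ℤ.* h n)
         (ℤ.+-identityˡ (+ n)) (spread-recurrence 0ℤ _ coefficients n) ⟩
  + 4 ℤ.* θ h n ℤ.+ + 18 ℤ.* h n
    ≡⟨ cong₂ ℤ._+_ (scaled (+ 4) (θ h)) (scaled (+ 18) h) ⟨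
  (constant (+ 4) *ₛ X³ *ₛ θ h) (3 + n) ℤ.+ (constant (+ 18) *ₛ X³ *ₛ h) (3 + n) ∎
  where
  open ≡-Reasoning
  h = inverseCube
  scaled : ∀ c f → (constant c *ₛ X³ *ₛ f) (3 + n) ≡ c ℤ.* f n
  scaled c f = trans (*ₛ-assoc (constant c) X³ f (3 + n))
    (trans (constant-*ₛ c (X³ *ₛ f) (3 + n)) (cong (c ℤ.*_) (X³*ₛ-+3 f n)))
  coefficients : ∀ i → (1ℤ ℤ.+ (0ℤ ℤ.+ + i)) ℤ.* + cubeCoeff (suc i) ≡ (+ 4 ℤ.* (0ℤ ℤ.+ + i) ℤ.+ + 6) ℤ.* + cubeCoeff i
  coefficients i rewrite ℤ.+-identityˡ (+ i) = begin
    + suc i ℤ.* + cubeCoeff (suc i)          ≡⟨ ℤ.pos-* (suc i) (cubeCoeff (suc i)) ⟨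
    + (suc i * cubeCoeff (suc i))          ≡⟨ cong +_ (cubeCoeff-suc i) ⟩
    + ((4 * i + 6) * cubeCoeff i)      ≡⟨ ℤ.pos-* (4 * i + 6) (cubeCoeff i) ⟩
    + (4 * i + 6) ℤ.* + cubeCoeff i      ≡⟨ cong (λ z → (z ℤ.+ + 6) ℤ.* + cubeCoeff i) (ℤ.pos-* 4 i) ⟩
    (+ 4 ℤ.* + i ℤ.+ + 6) ℤ.* + cubeCoeff i  ∎

-- The three factors on the right multiplied by q, by the long parenthesis and
-- by s² vanish for the generating series a, n, e of the classes cornerFilled 1,
-- cornerEmpty 3, cornerFilled 3; q is the quotient of a polynomial division.
cubicIdentity : ∀ x a n e →
  let 𝟙 = constant (+ 1) ; 𝟚 = constant (+ 2)
      s = 𝟙 -ₛ 𝟚 *ₛ x *ₛ a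
      m = 𝟚 *ₛ x *ₛ a +ₛ a *ₛ a *ₛ a
      p = x +ₛ a *ₛ a
      q = x *ₛ x *ₛ x *ₛ x -ₛ x *ₛ x *ₛ x *ₛ a *ₛ a +ₛ x *ₛ x *ₛ a *ₛ a *ₛ a *ₛ a
            +ₛ x *ₛ x *ₛ a -ₛ 𝟚 *ₛ x *ₛ a *ₛ a *ₛ a -ₛ constant (+ 3) *ₛ x +ₛ a *ₛ a
  in s *ₛ s *ₛ s *ₛ (𝟙 +ₛ e +ₛ n) -ₛ (𝟙 -ₛ x *ₛ x *ₛ x) *ₛ (𝟙 -ₛ x *ₛ x *ₛ x)
     ≗ q *ₛ (a -ₛ x *ₛ (x +ₛ a *ₛ a))
       +ₛ (s *ₛ s +ₛ s *ₛ x *ₛ a +ₛ x *ₛ x *ₛ (x *ₛ m +ₛ s *ₛ p +ₛ x *ₛ (s +ₛ m) +ₛ x *ₛ (s *ₛ n -ₛ m)))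
          *ₛ (n -ₛ (a *ₛ (x *ₛ n +ₛ p) +ₛ x *ₛ a +ₛ x *ₛ n *ₛ a))
       +ₛ s *ₛ s *ₛ (e -ₛ (x *ₛ a +ₛ x *ₛ (a *ₛ (e +ₛ n) +ₛ (x +ₛ x *ₛ n) *ₛ (x *ₛ n +ₛ p) +ₛ e *ₛ a)))
cubicIdentity = solve 4 (λ x a n e →
  let s = con 1ℤ :- con (+ 2) :* x :* a
      m = con (+ 2) :* x :* a :+ a :* a :* a
      p = x :+ a :* a
      q = x :* x :* x :* x :- x :* x :* x :* a :* a :+ x :* x :* a :* a :* a :* a
            :+ x :* x :* a :- con (+ 2) :* x :* a :* a :* a :- con (+ 3) :* x :+ a :* a
  in s :* s :* s :* (con 1ℤ :+ e :+ n) :- (con 1ℤ :- x :* x :* x) :* (con 1ℤ :- x :* x :* x)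
     := q :* (a :- x :* (x :+ a :* a))
       :+ (s :* s :+ s :* x :* a :+ x :* x :* (x :* m :+ s :* p :+ x :* (s :+ m) :+ x :* (s :* n :- m)))
          :* (n :- (a :* (x :* n :+ p) :+ x :* a :+ x :* n :* a))
       :+ s :* s :* (e :- (x :* a :+ x :* (a :* (e :+ n) :+ (x :+ x :* n) :* (x :* n :+ p) :+ e :* a))))
  (λ _ → refl)

-- Multiplying s³F = (1 - x³)² by h, the inverse of s³, gives F = (1 - 2x³ + x⁶) h. The coefficient
-- at 6 + k is read off with the negative term moved to the left.
cubicSolution : ∀ a n e →
  a ≗ X *ₛ (X +ₛ a *ₛ a) →
  n ≗ a *ₛ (X *ₛ n +ₛ (X +ₛ a *ₛ a)) +ₛ X *ₛ a +ₛ X *ₛ n *ₛ a →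
  e ≗ X *ₛ a +ₛ X *ₛ (a *ₛ (e +ₛ n) +ₛ (X +ₛ X *ₛ n) *ₛ (X *ₛ n +ₛ (X +ₛ a *ₛ a)) +ₛ e *ₛ a) →
  ∀ k → e (6 + k) ℤ.+ n (6 + k) ℤ.+ + 2 ℤ.* inverseCube (3 + k) ≡ inverseCube (6 + k) ℤ.+ inverseCube k
cubicSolution a n e a-eq n-eq e-eq k = begin
  e (6 + k) ℤ.+ n (6 + k) ℤ.+ + 2 ℤ.* h (3 + k)
    -- The summand 1 of F contributes 0 in degree 6 + k.
    ≡⟨ cong (λ z → z ℤ.+ n (6 + k) ℤ.+ + 2 ℤ.* h (3 + k)) (ℤ.+-identityˡ (e (6 + k))) ⟨
  F (6 + k) ℤ.+ + 2 ℤ.* h (3 + k)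
    ≡⟨ cong (λ z → F (6 + k) ℤ.+ + 2 ℤ.* z) (X³*ₛ-+3 h (3 + k)) ⟨
  F (6 + k) ℤ.+ + 2 ℤ.* (X³ *ₛ h) (6 + k)
    ≡⟨ cong (ℤ._+_ (F (6 + k))) (constant-*ₛ (+ 2) (X³ *ₛ h) (6 + k)) ⟨
  (F +ₛ 𝟚 *ₛ (X³ *ₛ h)) (6 + k)
    ≡⟨ F-formula (6 + k) ⟩
  h (6 + k) ℤ.+ (X³ *ₛ (X³ *ₛ h)) (6 + k)
    ≡⟨ cong (ℤ._+_ (h (6 + k))) (trans (X³*ₛ-+3 (X³ *ₛ h) (3 + k)) (X³*ₛ-+3 h k)) ⟩
  h (6 + k) ℤ.+ h k ∎
  where
  open ≡-Reasoning
  h = inverseCube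
  𝟚 = constant (+ 2)
  s = 𝟙 -ₛ 𝟚 *ₛ X *ₛ a
  F = 𝟙 +ₛ e +ₛ n

  s² : s *ₛ s ≗ 𝟙 -ₛ constant (+ 4) *ₛ X³
  s² = from-difference (R.trans
    (solve 2 (λ x a →
      let s = con 1ℤ :- con (+ 2) :* x :* a in
      s :* s :- (con 1ℤ :- con (+ 4) :* (x :* x :* x))
      := con (ℤ.- (+ 4)) :* x :* (a :- x :* (x :+ a :* a))) (λ _ → refl) X a)
    (zero-* (constant (ℤ.- (+ 4)) *ₛ X) (minus-zero _ _ a-eq)))

  s³h : s *ₛ s *ₛ s *ₛ h ≗ 𝟙
  s³h = cube-times-inverse-cube s h refl refl s² θ-inverseCube

  s³F : s *ₛ s *ₛ s *ₛ F ≗ (𝟙 -ₛ X³) *ₛ (𝟙 -ₛ X³)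
  s³F = from-difference (R.trans (cubicIdentity X a n e)
    (zero-+ (zero-+ (zero-* q (minus-zero _ _ a-eq)) (zero-* r (minus-zero _ _ n-eq)))
            (zero-* (s *ₛ s) (minus-zero _ _ e-eq))))
    where
    -- The equation of n, solved for its linear term, reads s n = `m`; the long multiplier `r`
    -- collects what the replacement of s n by `m` leaves behind.
    m = 𝟚 *ₛ X *ₛ a +ₛ a *ₛ a *ₛ a
    p = X +ₛ a *ₛ a
    q = X *ₛ X *ₛ X *ₛ X -ₛ X *ₛ X *ₛ X *ₛ a *ₛ a +ₛ X *ₛ X *ₛ a *ₛ a *ₛ a *ₛ a
            +ₛ X *ₛ X *ₛ a -ₛ 𝟚 *ₛ X *ₛ a *ₛ a *ₛ a -ₛ constant (+ 3) *ₛ X +ₛ a *ₛ a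
    r = s *ₛ s +ₛ s *ₛ X *ₛ a +ₛ X *ₛ X *ₛ (X *ₛ m +ₛ s *ₛ p +ₛ X *ₛ (s +ₛ m) +ₛ X *ₛ (s *ₛ n -ₛ m))

  F-formula : F +ₛ 𝟚 *ₛ (X³ *ₛ h) ≗ h +ₛ X³ *ₛ (X³ *ₛ h)
  F-formula = R.trans (R.+-congʳ {𝟚 *ₛ (X³ *ₛ h)} F≗) (solve 2 (λ x h →
      h :* ((con 1ℤ :- x) :* (con 1ℤ :- x)) :+ con (+ 2) :* (x :* h) := h :+ x :* (x :* h)) (λ _ → refl) X³ h)
    where
    F≗ : F ≗ h *ₛ ((𝟙 -ₛ X³) *ₛ (𝟙 -ₛ X³))
    F≗ = R.trans (R.sym (*ₛ-identityˡ F)) (R.trans (R.*-congʳ {F} (R.sym s³h)) (R.trans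
      (solve 3 (λ s h f → s :* s :* s :* h :* f := h :* (s :* s :* s :* f)) (λ _ → refl) s h F)
      (R.*-congˡ {h} s³F)))

-- The system of generating series

module _ {A : Set} where
  count-∷ : ∀ (f : A → Bool) x xs → count f (x ∷ xs) ≡ indicator (f x) + count f xs
  count-∷ f x xs = trans (count-++ f (x ∷ []) xs) (cong (_+ count f xs) (count-singleton f x))

  count-disjoint : ∀ {f g h : A → Bool} xs →
    (∀ {x} → x ∈ xs → indicator (f x) ≡ indicator (g x) + indicator (h x)) →
    count f xs ≡ count g xs + count h xs
  count-disjoint []       _ = refl
  count-disjoint {f} {g} {h} (x ∷ xs) e = begin
    count f (x ∷ xs)
      ≡⟨ count-∷ f x xs ⟩
    indicator (f x) + count f xs
      ≡⟨ cong₂ _+_ (e (here refl)) (count-disjoint xs (e ∘ there)) ⟩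
    (indicator (g x) + indicator (h x)) + (count g xs + count h xs)
      ≡⟨ +-interchange (indicator (g x)) (indicator (h x)) (count g xs) (count h xs) ⟩
    (indicator (g x) + count g xs) + (indicator (h x) + count h xs)
      ≡⟨ cong₂ _+_ (count-∷ g x xs) (count-∷ h x xs) ⟨
    count g (x ∷ xs) + count h (x ∷ xs) ∎
    where
    open ≡-Reasoning

  count-select : ∀ (f g : A → Bool) xs → count (λ x → g x ∧ f x) xs ≡ count f (select g xs)
  count-select f g []       = refl
  count-select f g (x ∷ xs) with g x
  ... | false = count-select f g xs
  ... | true with f x
  ...   | false = count-select f g xs
  ...   | true  = cong suc (count-select f g xs)

  weightSeries : (A → ℕ) → List A → Series
  weightSeries V xs u = + count (λ x → V x ≡ᵇ u) xs

-- Fixing the first component of a pair multiplies by the monomial of degree k, its weight.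
weightSeries-shift : ∀ {A : Set} (W : A → ℕ) ys k w →
  + count (λ y → k + W y ≡ᵇ w) ys ≡ ((λ u → + indicator (k ≡ᵇ u)) *ₛ weightSeries W ys) w
weightSeries-shift W ys zero    zero    = sym (ℤ.*-identityˡ _)
weightSeries-shift W ys zero    (suc w) = sym (trans
  (cong₂ ℤ._+_ (ℤ.*-identityˡ (weightSeries W ys (suc w))) (*ₛ-zeroˡ (weightSeries W ys) w)) (ℤ.+-identityʳ _))
weightSeries-shift W ys (suc k) zero    = cong +_ (count-false _ ys (λ _ → refl))
weightSeries-shift W ys (suc k) (suc w) = trans (weightSeries-shift W ys k w) (sym (ℤ.+-identityˡ _))

weightSeries-product : ∀ {A B : Set} (V : A → ℕ) (W : B → ℕ) xs ys →
  weightSeries (λ p → V (proj₁ p) + W (proj₂ p)) (cartesianProduct xs ys) ≗ weightSeries V xs *ₛ weightSeries W ys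
weightSeries-product V W []       ys w = sym (*ₛ-zeroˡ (weightSeries W ys) w)
weightSeries-product V W (x ∷ xs) ys w = begin
  + count f (map (x ,_) ys ++ cartesianProduct xs ys)
    ≡⟨ cong +_ (count-++ f (map (x ,_) ys) (cartesianProduct xs ys)) ⟩
  + count f (map (x ,_) ys) ℤ.+ weightSeries (λ p → V (proj₁ p) + W (proj₂ p)) (cartesianProduct xs ys) w
    ≡⟨ cong₂ ℤ._+_ (trans (cong +_ (count-map f (x ,_) ys)) (weightSeries-shift W ys (V x) w))
                   (weightSeries-product V W xs ys w) ⟩
  (δ *ₛ weightSeries W ys) w ℤ.+ (weightSeries V xs *ₛ weightSeries W ys) w
    ≡⟨ *ₛ-distribʳ (weightSeries W ys) δ (weightSeries V xs) w ⟨
  ((δ +ₛ weightSeries V xs) *ₛ weightSeries W ys) w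
    ≡⟨ *ₛ-cong {g = weightSeries W ys} (λ u → cong +_ (sym (count-∷ (λ x → V x ≡ᵇ u) x xs))) (λ _ → refl) w ⟩
  (weightSeries V (x ∷ xs) *ₛ weightSeries W ys) w ∎
  where
  open ≡-Reasoning
  δ : Series
  δ u = + indicator (V x ≡ᵇ u)
  f = λ p → V (proj₁ p) + W (proj₂ p) ≡ᵇ w

-- The product of series in two variables: the outer index is the weight, the inner one the size.
_*ₛₛ_ : (ℕ → Series) → (ℕ → Series) → ℕ → Series
_*ₛₛ_ = convolve _*ₛ_ _+ₛ_

*ₛₛ-zero : ∀ F G w → (F *ₛₛ G) w 0 ≡ ((λ u → F u 0) *ₛ (λ v → G v 0)) w
*ₛₛ-zero F G zero    = refl
*ₛₛ-zero F G (suc w) = cong (ℤ._+_ (F 0 0 ℤ.* G (suc w) 0)) (*ₛₛ-zero (F ∘ suc) G w)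

-- The product recurses on the weight, `⊗` on the size; this unfolds the product along the size so
-- that the two can be compared by induction.
*ₛₛ-suc : ∀ F G w n → (F *ₛₛ G) w (suc n) ≡
  ((λ u → F u 0) *ₛ (λ v → G v (suc n))) w ℤ.+ ((λ u → F u ∘ suc) *ₛₛ G) w n
*ₛₛ-suc F G zero    n = refl
*ₛₛ-suc F G (suc w) n = trans
  (cong (ℤ._+_ ((F 0 *ₛ G (suc w)) (suc n))) (*ₛₛ-suc (F ∘ suc) G w n))
  (interchange (F 0 0 ℤ.* G (suc w) (suc n)) ((F 0 ∘ suc *ₛ G (suc w)) n) _ _)
  where
  interchange : ∀ a b c d → (a ℤ.+ b) ℤ.+ (c ℤ.+ d) ≡ (a ℤ.+ c) ℤ.+ (b ℤ.+ d)
  interchange = ℤ-Solver.solve-∀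

weightSeries-⊗ : ∀ {A B : Set} (V : A → ℕ) (W : B → ℕ) (f : ℕ → List A) (g : ℕ → List B) n w →
  weightSeries (λ p → V (proj₁ p) + W (proj₂ p)) ((f ⊗ g) n) w
  ≡ ((λ u i → weightSeries V (f i) u) *ₛₛ (λ v j → weightSeries W (g j) v)) w n
weightSeries-⊗ V W f g zero    w = trans (weightSeries-product V W (f 0) (g 0) w) (sym (*ₛₛ-zero _ _ w))
weightSeries-⊗ V W f g (suc n) w = begin
  + count h (cartesianProduct (f 0) (g (suc n)) ++ ((f ∘ suc) ⊗ g) n)
    ≡⟨ cong +_ (count-++ h (cartesianProduct (f 0) (g (suc n))) (((f ∘ suc) ⊗ g) n)) ⟩
  + count h (cartesianProduct (f 0) (g (suc n))) ℤ.+ + count h (((f ∘ suc) ⊗ g) n)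
    ≡⟨ cong₂ ℤ._+_ (weightSeries-product V W (f 0) (g (suc n)) w) (weightSeries-⊗ V W (f ∘ suc) g n w) ⟩
  _ ≡⟨ *ₛₛ-suc (λ u i → weightSeries V (f i) u) (λ v j → weightSeries W (g j) v) w n ⟨
  _ ∎
  where
  open ≡-Reasoning
  h = λ p → V (proj₁ p) + W (proj₂ p) ≡ᵇ w

-- The first argument is the weight, the second the size.
byWeight cornerFilled cornerEmpty byLeftWeight : ℕ → Series
byWeight  w n = weightSeries weight (avoiders n) w
byLeftWeight w n = weightSeries leftWeight (avoiders n) w
cornerFilled w n = + count (λ π → topRightNonempty π ∧ (weight π ≡ᵇ w)) (avoiders n)
cornerEmpty w n = + count (λ π → not (topRightNonempty π) ∧ (weight π ≡ᵇ w)) (avoiders n)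

byWeight-suc : ∀ w n → byWeight w (suc n) ≡ (byLeftWeight *ₛₛ byWeight) w n
byWeight-suc w n = trans
  (cong +_ (trans (count-avoiders-suc (λ π → weight π ≡ᵇ w) n)
    (count-cong ((avoiders ⊗ avoiders) n) λ { {α , β} p → let (A , B , _) = ∈-pairs⁻ n p in cong (_≡ᵇ w) (weight-glue A B) })))
  (weightSeries-⊗ leftWeight weight avoiders avoiders n w)

byWeight-split : ∀ w n → byWeight w n ≡ cornerFilled w n ℤ.+ cornerEmpty w n
byWeight-split w n = cong +_ (count-disjoint (avoiders n) λ {π} _ → split (topRightNonempty π) (weight π ≡ᵇ w))
  where
  split : ∀ t b → indicator b ≡ indicator (t ∧ b) + indicator (not t ∧ b)
  split true  b = sym (+-identityʳ (indicator b))
  split false b = refl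

-- The corner is filled exactly for `glue α []` with α nonempty, and then the weight is the left
-- weight of α.
cornerFilled-avoiders : ∀ w n → cornerFilled w (suc n) ≡ + count (λ α → not (null α) ∧ (leftWeight α ≡ᵇ w)) (avoiders n)
cornerFilled-avoiders w n = cong +_ (begin
  count (λ π → topRightNonempty π ∧ (weight π ≡ᵇ w)) (avoiders (suc n))
    ≡⟨ count-select (λ π → weight π ≡ᵇ w) topRightNonempty (avoiders (suc n)) ⟩
  count (λ π → weight π ≡ᵇ w) (select topRightNonempty (avoiders (suc n)))
    ≡⟨ count-same-members (Unique.filter⁺ _ (avoiders-unique (suc n)))
         (map-unique capped
           (λ {α} {α′} α∈ α′∈ e → proj₁ (glue-injective {α} {[]} {α′} {[]} (avoider-of α∈) (avoider-of α′∈) e))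
           (Unique.filter⁺ _ (avoiders-unique n)))
         to from (λ π → weight π ≡ᵇ w) ⟩
  count (λ π → weight π ≡ᵇ w) (map capped nonnull)
    ≡⟨ count-map (λ π → weight π ≡ᵇ w) capped nonnull ⟩
  count (λ α → weight (capped α) ≡ᵇ w) nonnull
    ≡⟨ count-cong nonnull (λ α∈ → cong (_≡ᵇ w) (trans (weight-glue (avoider-of α∈) empty) (+-identityʳ _))) ⟩
  count (λ α → leftWeight α ≡ᵇ w) nonnull
    ≡⟨ count-select (λ α → leftWeight α ≡ᵇ w) (not ∘ null) (avoiders n) ⟨
  count (λ α → not (null α) ∧ (leftWeight α ≡ᵇ w)) (avoiders n) ∎)
  where
  open ≡-Reasoning
  capped : List ℕ → List ℕ
  capped α = glue α []
  nonnull = select (not ∘ null) (avoiders n)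
  empty : Avoider []
  empty = avoider [] [] (λ _ _ ())
  member : ∀ {α} → α ∈ nonnull → α ∈ avoiders n × not (null α) ≡ true
  member = ∈-filter⁻ (λ α → not (null α) ≟ᵇ true) {xs = avoiders n}
  avoider-of : ∀ {α} → α ∈ nonnull → Avoider α
  avoider-of α∈ = proj₁ (∈-avoiders⁻ n (proj₁ (member α∈)))
  to : ∀ {π} → π ∈ select topRightNonempty (avoiders (suc n)) → π ∈ map capped nonnull
  to {π} π∈ with ∈-filter⁻ (λ π → topRightNonempty π ≟ᵇ true) {xs = avoiders (suc n)} π∈
  ... | π∈′ , tr with ∈-avoiders⁻ (suc n) π∈′
  ...   | A , len with decompose A len
  ...     | α , y ∷ β , _ , B , refl = contradiction (trans (sym tr) (topRight-glue-∷ α y β (bounded B))) λ ()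
  ...     | α , [] , A₁ , _ , refl = ∈-map⁺ capped (∈-filter⁺ (λ α → not (null α) ≟ᵇ true)
    (∈-avoiders⁺ A₁ (trans (sym (+-identityʳ (length α))) (suc-injective (trans (sym (length-glue α [])) len))))
    (trans (sym (topRight-glue-[] α (bounded A₁))) tr))
  from : ∀ {π} → π ∈ map capped nonnull → π ∈ select topRightNonempty (avoiders (suc n))
  from π∈ with ∈-map⁻ capped π∈
  ... | α , α∈ , refl = let (α∈′ , nn) = member α∈ ; (A , len) = ∈-avoiders⁻ n α∈′ in
    ∈-filter⁺ (λ π → topRightNonempty π ≟ᵇ true)
      (∈-avoiders⁺ (glue-avoider A empty) (trans (length-glue α []) (cong suc (trans (+-identityʳ (length α)) len))))
      (trans (topRight-glue-[] α (bounded A)) nn)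

nonempty-avoider : ∀ n {π} → π ∈ avoiders (suc n) → ∃₂ λ x α → π ≡ x ∷ α × Avoider (x ∷ α)
nonempty-avoider n {[]}    π∈ = contradiction (proj₂ (∈-avoiders⁻ (suc n) π∈)) λ ()
nonempty-avoider n {x ∷ α} π∈ = x , α , refl , proj₁ (∈-avoiders⁻ (suc n) π∈)

-- The correction stands for the empty α, of left weight 2: it yields the single-entry permutation,
-- whose corner is empty.
cornerFilled-suc : ∀ w n → cornerFilled w (suc n) ℤ.+ constant (+ indicator (2 ≡ᵇ w)) n ≡ byLeftWeight w n
cornerFilled-suc w zero    = trans (cong (ℤ._+ + indicator (2 ≡ᵇ w)) (cornerFilled-avoiders w 0))
  (sym (cong +_ (count-singleton (λ α → leftWeight α ≡ᵇ w) [])))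
cornerFilled-suc w (suc n) = trans (ℤ.+-identityʳ _) (trans (cornerFilled-avoiders w (suc n))
  (cong +_ (count-cong (avoiders (suc n)) λ π∈ → nonnull (nonempty-avoider n π∈))))
  where
  nonnull : ∀ {π} → (∃₂ λ x α → π ≡ x ∷ α × Avoider (x ∷ α)) →
    not (null π) ∧ (leftWeight π ≡ᵇ w) ≡ (leftWeight π ≡ᵇ w)
  nonnull (_ , _ , refl , _) = refl

vanishing : ∀ {f : List ℕ → Bool} n → (∀ {x α} → Avoider (x ∷ α) → f (x ∷ α) ≡ false) →
  + count f (avoiders (suc n)) ≡ 0ℤ
vanishing {f} n e = cong +_ (count-false f (avoiders (suc n)) (λ π∈ → go (nonempty-avoider n π∈)))
  where
  go : ∀ {π} → (∃₂ λ x α → π ≡ x ∷ α × Avoider (x ∷ α)) → f π ≡ false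
  go (_ , _ , refl , A) = e A

positive-≢ᵇ0 : ∀ {m} → 1 ≤ m → (m ≡ᵇ 0) ≡ false
positive-≢ᵇ0 (s≤s _) = refl

positive-weight : ∀ {x α} → Avoider (x ∷ α) → (weight (x ∷ α) ≡ᵇ 0) ≡ false
positive-weight {x} {α} A = positive-≢ᵇ0 (≤-trans (1≤slack x α) (slack≤weight A))

by-cases : ∀ {P : Set} b → (b ≡ true → P) → (b ≡ false → P) → P
by-cases true  t f = t refl
by-cases false t f = f refl

byWeight0 : byWeight 0 ≗ constant 1ℤ
byWeight0 zero    = refl
byWeight0 (suc n) = vanishing n positive-weight

cornerFilled0 : cornerFilled 0 ≗ (λ _ → 0ℤ)
cornerFilled0 zero    = refl
cornerFilled0 (suc n) = vanishing {λ π → topRightNonempty π ∧ (weight π ≡ᵇ 0)} n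
  λ {x} {α} A → trans (cong (topRightNonempty (x ∷ α) ∧_) (positive-weight A)) (∧-zeroʳ _)

cornerEmpty1 : cornerEmpty 1 ≗ (λ _ → 0ℤ)
cornerEmpty1 zero    = refl
cornerEmpty1 (suc n) = vanishing {λ π → not (topRightNonempty π) ∧ (weight π ≡ᵇ 1)} n go
  where
  go : ∀ {x α} → Avoider (x ∷ α) → not (topRightNonempty (x ∷ α)) ∧ (weight (x ∷ α) ≡ᵇ 1) ≡ false
  go {x} {α} A = by-cases (topRightNonempty (x ∷ α))
    (λ e → cong (λ t → not t ∧ (weight (x ∷ α) ≡ᵇ 1)) e)
    (λ e → let (v , _ , we) = leftWeight-¬topRight A e in
      cong₂ (λ t k → not t ∧ (k ≡ᵇ 1)) e we)

byLeftWeight0 : byLeftWeight 0 ≗ (λ _ → 0ℤ)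
byLeftWeight0 zero    = refl
byLeftWeight0 (suc n) = vanishing {λ π → leftWeight π ≡ᵇ 0} n go
  where
  go : ∀ {x α} → Avoider (x ∷ α) → (leftWeight (x ∷ α) ≡ᵇ 0) ≡ false
  go {x} {α} A = by-cases (topRightNonempty (x ∷ α))
    (λ e → cong (_≡ᵇ 0) (leftWeight-topRight A e))
    (λ e → let (v , le , _) = leftWeight-¬topRight A e in cong (_≡ᵇ 0) le)

-- A filled corner raises the weight by 2 and an empty one lowers it by 1, so left weight w + 1
-- stems from weight w - 1 or w + 2. Writing 1 + weight = w leaves the first class empty at w = 0.
byLeftWeight-suc : ∀ w n → byLeftWeight (suc w) (suc n) ≡
  + count (λ π → topRightNonempty π ∧ (1 + weight π ≡ᵇ w)) (avoiders (suc n)) ℤ.+ cornerEmpty (2 + w) (suc n)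
byLeftWeight-suc w n = cong +_ (count-disjoint (avoiders (suc n)) (λ π∈ → go (nonempty-avoider n π∈)))
  where
  go : ∀ {π} → (∃₂ λ x α → π ≡ x ∷ α × Avoider (x ∷ α)) →
    indicator (leftWeight π ≡ᵇ suc w) ≡ indicator (topRightNonempty π ∧ (1 + weight π ≡ᵇ w))
      + indicator (not (topRightNonempty π) ∧ (weight π ≡ᵇ 2 + w))
  go (x , α , refl , A) = by-cases (topRightNonempty (x ∷ α))
    (λ e → trans (cong (λ l → indicator (l ≡ᵇ suc w)) (leftWeight-topRight A e))
      (sym (trans (cong (λ t → parts t (weight (x ∷ α))) e) (+-identityʳ _))))
    (λ e → let (v , le , we) = leftWeight-¬topRight A e in
      trans (cong (λ l → indicator (l ≡ᵇ suc w)) le) (sym (cong₂ parts e we)))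
    where
    parts : Bool → ℕ → ℕ
    parts t k = indicator (t ∧ (1 + k ≡ᵇ w)) + indicator (not t ∧ (k ≡ᵇ 2 + w))

byLeftWeight1 : byLeftWeight 1 ≗ cornerEmpty 2
byLeftWeight1 zero    = refl
byLeftWeight1 (suc n) = trans (byLeftWeight-suc 0 n) (trans (cong (ℤ._+ cornerEmpty 2 (suc n))
  (vanishing {λ π → topRightNonempty π ∧ (1 + weight π ≡ᵇ 0)} n
    (λ {x} {α} _ → ∧-zeroʳ (topRightNonempty (x ∷ α))))) (ℤ.+-identityˡ _))

byLeftWeight2 : byLeftWeight 2 ≗ constant 1ℤ +ₛ cornerEmpty 3
byLeftWeight2 zero    = refl
byLeftWeight2 (suc n) = trans (byLeftWeight-suc 1 n) (cong (ℤ._+ cornerEmpty 3 (suc n)) (cornerFilled0 (suc n)))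

byLeftWeight3 : byLeftWeight 3 ≗ cornerFilled 1 +ₛ cornerEmpty 4
byLeftWeight3 zero    = refl
byLeftWeight3 (suc n) = byLeftWeight-suc 2 n

-- The elimination is purely algebraic and is done for arbitrary series. `l₄`, which would bring in
-- weight 5, disappears because X `l₄` is `e₄` and `e₄` also stands on the left of `eq₄`.
module Reduction (a b e e₄ p n q l₃ l₄ : Series)
  (a-eq : a ≗ X *ₛ p) (b-eq : b ≗ X *ₛ n) (e-eq : e ≗ X *ₛ l₃) (e₄-eq : e₄ ≗ X *ₛ l₄) (l₃-eq : l₃ ≗ a +ₛ q)
  (eq₂ : b +ₛ p ≗ X *ₛ (p *ₛ a +ₛ (𝟙 +ₛ n)))
  (eq₃ : e +ₛ n ≗ X *ₛ (p *ₛ (b +ₛ p) +ₛ ((𝟙 +ₛ n) *ₛ a +ₛ l₃)))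
  (eq₄ : e₄ +ₛ q ≗ X *ₛ (p *ₛ (e +ₛ n) +ₛ ((𝟙 +ₛ n) *ₛ (b +ₛ p) +ₛ (l₃ *ₛ a +ₛ l₄)))) where
  private
    ha = minus-zero a (X *ₛ p) a-eq
    hb = minus-zero b (X *ₛ n) b-eq
    he = minus-zero e (X *ₛ l₃) e-eq
    he₄ = minus-zero e₄ (X *ₛ l₄) e₄-eq
    hl = minus-zero l₃ (a +ₛ q) l₃-eq
    h₂ = minus-zero (b +ₛ p) (X *ₛ (p *ₛ a +ₛ (𝟙 +ₛ n))) eq₂
    h₃ = minus-zero (e +ₛ n) (X *ₛ (p *ₛ (b +ₛ p) +ₛ ((𝟙 +ₛ n) *ₛ a +ₛ l₃))) eq₃
    h₄ = minus-zero (e₄ +ₛ q) (X *ₛ (p *ₛ (e +ₛ n) +ₛ ((𝟙 +ₛ n) *ₛ (b +ₛ p) +ₛ (l₃ *ₛ a +ₛ l₄)))) eq₄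

    p-formula : p ≗ X +ₛ a *ₛ a
    p-formula = from-difference (R.trans
      (solve 5 (λ x a b p n → p :- (x :+ a :* a) :=
        -- The terms `b` and X `n` cancel, and X `p` is `a`.
        (b :+ p :- x :* (p :* a :+ (con 1ℤ :+ n))) :- (b :- x :* n) :- a :* (a :- x :* p)) (λ _ → refl) X a b p n)
      (zero-- (zero-- h₂ hb) (zero-* a ha)))

    hp = minus-zero p (X +ₛ a *ₛ a) p-formula

  reduced-a : a ≗ X *ₛ (X +ₛ a *ₛ a)
  reduced-a = R.trans a-eq (R.*-congˡ {X} p-formula)

  reduced-n : n ≗ a *ₛ (X *ₛ n +ₛ (X +ₛ a *ₛ a)) +ₛ X *ₛ a +ₛ X *ₛ n *ₛ a
  reduced-n = from-difference (R.trans
    (solve 7 (λ x a b e p n l →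
      n :- (a :* (x :* n :+ (x :+ a :* a)) :+ x :* a :+ x :* n :* a) :=
        (e :+ n :- x :* (p :* (b :+ p) :+ ((con 1ℤ :+ n) :* a :+ l))) :- (e :- x :* l)
        :+ a :* (b :- x :* n :+ (p :- (x :+ a :* a))) :- (b :+ p) :* (a :- x :* p))
      (λ _ → refl) X a b e p n l₃)
    (zero-- (zero-+ (zero-- h₃ he) (zero-* a (zero-+ hb hp))) (zero-* (b +ₛ p) ha)))

  -- As `e` is X(`a` + `q`), it suffices to extract `q` from `eq₄`, where X `p`, X `l₃` and X `l₄`
  -- become `a`, `e` and `e₄`.
  reduced-e : e ≗ X *ₛ a +ₛ X *ₛ (a *ₛ (e +ₛ n) +ₛ (X +ₛ X *ₛ n) *ₛ (X *ₛ n +ₛ (X +ₛ a *ₛ a)) +ₛ e *ₛ a)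
  reduced-e = from-difference (R.trans
    (solve 10 (λ x a b e e₄ p n q l₃ l₄ →
      e :- (x :* a :+ x :* (a :* (e :+ n) :+ (x :+ x :* n) :* (x :* n :+ (x :+ a :* a)) :+ e :* a)) :=
        (e :- x :* l₃) :+ x :* (l₃ :- (a :+ q))
        :+ x :* ((e₄ :+ q :- x :* (p :* (e :+ n) :+ ((con 1ℤ :+ n) :* (b :+ p) :+ (l₃ :* a :+ l₄))))
                 :- (e₄ :- x :* l₄) :- (e :+ n) :* (a :- x :* p)
                 :+ (x :+ x :* n) :* (b :- x :* n :+ (p :- (x :+ a :* a))) :- a :* (e :- x :* l₃)))
      (λ _ → refl) X a b e e₄ p n q l₃ l₄)
    (zero-+ (zero-+ he (zero-* X hl)) (zero-* X
      (zero-- (zero-+ (zero-- (zero-- h₄ he₄) (zero-* (e +ₛ n) ha)) (zero-* (X +ₛ X *ₛ n) (zero-+ hb hp))) (zero-* a he)))))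

byWeight-shift : ∀ w → byWeight (suc w) ≗ X *ₛ (byLeftWeight *ₛₛ byWeight) (suc w)
byWeight-shift w = shift-by-X refl (byWeight-suc (suc w))

cornerFilled1-shift : cornerFilled 1 ≗ X *ₛ cornerEmpty 2
cornerFilled1-shift = R.trans (shift-by-X refl (λ n → trans (sym (plus-zero n)) (cornerFilled-suc 1 n))) (R.*-congˡ {X} byLeftWeight1)
  where
  plus-zero : ∀ n → cornerFilled 1 (suc n) ℤ.+ constant 0ℤ n ≡ cornerFilled 1 (suc n)
  plus-zero zero    = ℤ.+-identityʳ _
  plus-zero (suc n) = ℤ.+-identityʳ _

cornerFilled-shift : ∀ w → cornerFilled (3 + w) ≗ X *ₛ byLeftWeight (3 + w)
cornerFilled-shift w = shift-by-X refl (λ n → trans (sym (plus-zero n)) (cornerFilled-suc (3 + w) n))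
  where
  plus-zero : ∀ n → cornerFilled (3 + w) (suc n) ℤ.+ constant 0ℤ n ≡ cornerFilled (3 + w) (suc n)
  plus-zero zero    = ℤ.+-identityʳ _
  plus-zero (suc n) = ℤ.+-identityʳ _

cornerFilled2-shift : cornerFilled 2 ≗ X *ₛ cornerEmpty 3
cornerFilled2-shift = shift-by-X refl λ n → ∙-cancelʳ (constant 1ℤ n) _ _
  (trans (cornerFilled-suc 2 n) (trans (byLeftWeight2 n) (ℤ.+-comm (constant 1ℤ n) (cornerEmpty 3 n))))

byWeight1 : byWeight 1 ≗ cornerFilled 1
byWeight1 n = trans (byWeight-split 1 n) (trans (cong (ℤ._+_ (cornerFilled 1 n)) (cornerEmpty1 n)) (ℤ.+-identityʳ _))

byLeftWeight0-*ₛ : ∀ f → byLeftWeight 0 *ₛ f ≗ 𝟘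
byLeftWeight0-*ₛ f = R.trans (R.*-congʳ {f} byLeftWeight0) (R.trans (*ₛ-zeroˡ f) (λ { zero → refl ; (suc _) → refl }))

equation₂ : cornerFilled 2 +ₛ cornerEmpty 2 ≗ X *ₛ (cornerEmpty 2 *ₛ cornerFilled 1 +ₛ (𝟙 +ₛ cornerEmpty 3))
equation₂ = R.trans (R.sym (byWeight-split 2)) (R.trans (byWeight-shift 1) (R.*-congˡ {X} (R.trans
  (R.+-cong (byLeftWeight0-*ₛ (byWeight 2)) (R.+-cong (*ₛ-cong byLeftWeight1 byWeight1) (*ₛ-cong byLeftWeight2 byWeight0)))
  (solve 3 (λ p a n → con 0ℤ :+ (p :* a :+ (con 1ℤ :+ n) :* con 1ℤ) := p :* a :+ (con 1ℤ :+ n)) (λ _ → refl)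
    (cornerEmpty 2) (cornerFilled 1) (cornerEmpty 3)))))

equation₃ : cornerFilled 3 +ₛ cornerEmpty 3 ≗
  X *ₛ (cornerEmpty 2 *ₛ (cornerFilled 2 +ₛ cornerEmpty 2) +ₛ ((𝟙 +ₛ cornerEmpty 3) *ₛ cornerFilled 1 +ₛ byLeftWeight 3))
equation₃ = R.trans (R.sym (byWeight-split 3)) (R.trans (byWeight-shift 2) (R.*-congˡ {X} (R.trans
  (R.+-cong (byLeftWeight0-*ₛ (byWeight 3)) (R.+-cong (*ₛ-cong byLeftWeight1 (byWeight-split 2))
    (R.+-cong (*ₛ-cong byLeftWeight2 byWeight1) (R.*-congˡ {byLeftWeight 3} byWeight0))))
  (solve 5 (λ p a b n l → con 0ℤ :+ (p :* b :+ ((con 1ℤ :+ n) :* a :+ l :* con 1ℤ)) := p :* b :+ ((con 1ℤ :+ n) :* a :+ l))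
    (λ _ → refl) (cornerEmpty 2) (cornerFilled 1) (cornerFilled 2 +ₛ cornerEmpty 2) (cornerEmpty 3) (byLeftWeight 3)))))

equation₄ : cornerFilled 4 +ₛ cornerEmpty 4 ≗
  X *ₛ (cornerEmpty 2 *ₛ (cornerFilled 3 +ₛ cornerEmpty 3) +ₛ ((𝟙 +ₛ cornerEmpty 3) *ₛ (cornerFilled 2 +ₛ cornerEmpty 2)
    +ₛ (byLeftWeight 3 *ₛ cornerFilled 1 +ₛ byLeftWeight 4)))
equation₄ = R.trans (R.sym (byWeight-split 4)) (R.trans (byWeight-shift 3) (R.*-congˡ {X} (R.trans
  (R.+-cong (byLeftWeight0-*ₛ (byWeight 4)) (R.+-cong (*ₛ-cong byLeftWeight1 (byWeight-split 3))
    (R.+-cong (*ₛ-cong byLeftWeight2 (byWeight-split 2))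
      (R.+-cong (R.*-congˡ {byLeftWeight 3} byWeight1) (R.*-congˡ {byLeftWeight 4} byWeight0)))))
  (solve 7 (λ p a b c n l k → con 0ℤ :+ (p :* c :+ ((con 1ℤ :+ n) :* b :+ (l :* a :+ k :* con 1ℤ)))
      := p :* c :+ ((con 1ℤ :+ n) :* b :+ (l :* a :+ k)))
    (λ _ → refl) (cornerEmpty 2) (cornerFilled 1) (cornerFilled 2 +ₛ cornerEmpty 2)
    (cornerFilled 3 +ₛ cornerEmpty 3) (cornerEmpty 3) (byLeftWeight 3) (byLeftWeight 4)))))

module Reduced = Reduction (cornerFilled 1) (cornerFilled 2) (cornerFilled 3) (cornerFilled 4)
  (cornerEmpty 2) (cornerEmpty 3) (cornerEmpty 4) (byLeftWeight 3) (byLeftWeight 4)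
  cornerFilled1-shift cornerFilled2-shift (cornerFilled-shift 0) (cornerFilled-shift 1) byLeftWeight3
  equation₂ equation₃ equation₄

byWeight3-formula : ∀ k →
  byWeight 3 (6 + k) ℤ.+ + 2 ℤ.* inverseCube (3 + k) ≡ inverseCube (6 + k) ℤ.+ inverseCube k
byWeight3-formula k = trans (cong (ℤ._+ + 2 ℤ.* inverseCube (3 + k)) (byWeight-split 3 (6 + k)))
  (cubicSolution (cornerFilled 1) (cornerEmpty 3) (cornerFilled 3)
    Reduced.reduced-a Reduced.reduced-n Reduced.reduced-e k)

-- From the weight-3 series to J

≡ᵇ-ext : ∀ {m n m′ n′} → (m ≡ n → m′ ≡ n′) → (m′ ≡ n′ → m ≡ n) → (m ≡ᵇ n) ≡ (m′ ≡ᵇ n′)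
≡ᵇ-ext {m} {n} {m′} {n′} to from with m ≡ᵇ n in e | m′ ≡ᵇ n′ in e′
... | true  | true  = refl
... | false | false = refl
... | true  | false = trans (sym (trans (cong (_≡ᵇ n′) (to (≡ᵇ⇒≡ m n (≡true⇒T e)))) (≡ᵇ-refl n′))) e′
... | false | true  = trans (sym e) (trans (cong (_≡ᵇ n) (from (≡ᵇ⇒≡ m′ n′ (≡true⇒T e′)))) (≡ᵇ-refl n))

-- 2 · 3i - 3(2i - 1) = 3. That weight 3 conversely forces 2i - 1 boxes rests on 3k ≤ 2ℓ, without
-- which truncation would lose information.
J-weight : ∀ m → J (3 * suc m) (2 * suc m ∸ 1) ≡ count (λ π → weight π ≡ᵇ 3) (avoiders (3 * suc m))
J-weight m = begin
  count (λ π → avoids132 π ∧ (nonzeroBoxes π ≡ᵇ 2 * suc m ∸ 1)) (permutations (3 * suc m))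
    ≡⟨ count-select (λ π → nonzeroBoxes π ≡ᵇ 2 * suc m ∸ 1) avoids132 (permutations (3 * suc m)) ⟩
  count (λ π → nonzeroBoxes π ≡ᵇ 2 * suc m ∸ 1) (avoiders (3 * suc m))
    ≡⟨ count-cong (avoiders (3 * suc m)) (λ {π} π∈ → let (A , len) = ∈-avoiders⁻ (3 * suc m) π∈ in
         ≡ᵇ-ext (to π len) (from π A len)) ⟩
  count (λ π → weight π ≡ᵇ 3) (avoiders (3 * suc m)) ∎
  where
  open ≡-Reasoning
  k = 2 * suc m ∸ 1
  double : ∀ m → 2 * (3 * suc m) ≡ 3 * (m + suc (m + 0)) + 3
  double = solve-∀
  to : ∀ π → length π ≡ 3 * suc m → nonzeroBoxes π ≡ k → weight π ≡ 3
  to π len e = trans (cong₂ (λ l b → 2 * l ∸ 3 * b) len e)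
    (trans (cong (_∸ 3 * k) (double m)) (m+n∸m≡n (3 * k) 3))
  from : ∀ π → Avoider π → length π ≡ 3 * suc m → weight π ≡ 3 → nonzeroBoxes π ≡ k
  from π A len e = *-cancelˡ-≡ (nonzeroBoxes π) k 3 (+-cancelʳ-≡ 3 _ _
    (trans (cong (λ w → 3 * nonzeroBoxes π + w) (sym e)) (trans (m+[n∸m]≡n (boxes≤ A))
      (trans (cong (2 *_) len) (double m)))))

J-formula : ∀ m → J (3 * (2 + m)) (2 * (2 + m) ∸ 1) + 2 * cubeCoeff (suc m) ≡ cubeCoeff (2 + m) + cubeCoeff m
J-formula m = ℤ.+-injective (begin
  + (J (3 * (2 + m)) (2 * (2 + m) ∸ 1) + 2 * cubeCoeff (suc m))
    ≡⟨ cong (λ j → + (j + 2 * cubeCoeff (suc m))) (J-weight (suc m)) ⟩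
  byWeight 3 (3 * (2 + m)) ℤ.+ + (2 * cubeCoeff (suc m))
    -- With the factor 3 on the right, (2 + m) * 3 computes to 6 + m * 3, the form in which `spread`
    -- unfolds.
    ≡⟨ cong₂ ℤ._+_ (cong (byWeight 3) (*-comm 3 (2 + m))) (ℤ.pos-* 2 (cubeCoeff (suc m))) ⟩
  byWeight 3 (6 + m * 3) ℤ.+ + 2 ℤ.* + cubeCoeff (suc m)
    ≡⟨ cong (λ c → byWeight 3 (6 + m * 3) ℤ.+ + 2 ℤ.* c) (spread-3* (+_ ∘ cubeCoeff) (suc m)) ⟨
  byWeight 3 (6 + m * 3) ℤ.+ + 2 ℤ.* inverseCube (3 + m * 3)
    ≡⟨ byWeight3-formula (m * 3) ⟩
  inverseCube (6 + m * 3) ℤ.+ inverseCube (m * 3)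
    ≡⟨ cong₂ ℤ._+_ (spread-3* (+_ ∘ cubeCoeff) (2 + m)) (spread-3* (+_ ∘ cubeCoeff) m) ⟩
  + (cubeCoeff (2 + m) + cubeCoeff m) ∎)
  where open ≡-Reasoning

theorem2p10 : (i : ℕ) → 1 ≤ i →
    (i ≡ 1 → (J (3 * i) (2 * i ∸ 1) ≡ J 3 1) × (J 3 1 ≡ 4)) ×
    (2 ≤ i → 2 * (i ∸ 1) * J (3 * i) (2 * i ∸ 1)
               ≡ ((2 * i ∸ 2) C i) * (9 * i ^ 2 + 3 * i ∸ 4))
-- The value J(3, 1) = 4 is found by evaluating the enumeration.
theorem2p10 i _ = (λ { refl → refl , refl }) , large i
  where
  large : ∀ i → 2 ≤ i → 2 * (i ∸ 1) * J (3 * i) (2 * i ∸ 1) ≡ ((2 * i ∸ 2) C i) * (9 * i ^ 2 + 3 * i ∸ 4)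
  large 1 (s≤s ())
  large (suc (suc m)) _ = trans (closedForm m _ (J-formula m))
    (cong₂ (λ c d → (c C (2 + m)) * d) (sym (cong (_∸ 2) (*-suc 2 (suc m))))
      (sym (trans (cong (_∸ 4) (square m)) (m+n∸n≡m _ 4))))
    where
    -- The solver does not handle the exponentiation, which is therefore unfolded.
    square : ∀ m → 9 * ((2 + m) * ((2 + m) * 1)) + 3 * (2 + m) ≡ 9 * m * m + 39 * m + 38 + 4
    square = solve-∀
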